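{- Let $G$ be a graph on $n$ vertices, and let $h,k$ be integers such that $1\le h\le k\le n/2$. If $\lambda$ is a Laplacian eigenvalue of $F_h(G)$ (an eigenvalue of the Laplacian matrix of $F_h(G)$), then $\lambda$ is a Laplacian eigenvalue of $F_k(G)$.
   Context: All graphs are finite and simple. For a graph $G$ with vertex set $[n]=\{1,\dots,n\}$ and $1\le k\le n$, the $k$-token graph $F_k(G)$ has as vertices the $k$-subsets of $[n]$; two vertices $A,B$ are adjacent iff $A\bigtriangleup B=\{a,b\}$ with $a\in A$, $b\in B$ and $\{a,b\}$ an edge of $G$. The Laplacian matrix of a graph is the diagonal degree matrix minus the adjacency matrix. -}

module Defs where

open import Data.Bool.Base using (true; false)
open import Data.Bool.Properties using () renaming (_≟_ to _≟ᵇ_)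
open import Data.Fin.Base using (Fin)
open import Data.Fin.Properties using (any?)
open import Data.Fin.Subset using (Subset; inside; outside; _∈_; _∉_; _∪_; _─_; ⁅_⁆; ∣_∣)
open import Data.Fin.Subset.Properties using (_∈?_; x∈⁅x⁆; x∈p∪q⁺; x∈p∪q⁻; ∪-comm)
open import Data.Integer.Base as ℤ using (ℤ; 0ℤ; 1ℤ)
open import Data.List.Base using (List; []; _∷_; _++_; map; filter; foldr; length)
open import Data.List.Membership.Propositional using () renaming (_∈_ to _∈ˡ_)
open import Data.List.Membership.Propositional.Properties using (∈-map⁺; ∈-map⁻; ∈-++⁺ˡ; ∈-++⁺ʳ)
open import Data.List.Relation.Unary.All using ([])
open import Data.List.Relation.Unary.AllPairs using ([]; _∷_)
open import Data.List.Relation.Unary.Any using (here)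
open import Data.List.Relation.Unary.Unique.Propositional using (Unique)
import Data.List.Relation.Unary.Unique.Propositional.Properties as Unique
open import Data.Nat.Base as ℕ using (ℕ; zero; suc)
import Data.Nat.Properties as ℕ
open import Data.Product.Base using (∃; ∃-syntax; _×_; _,_)
open import Data.Rational.Base as ℚ using (ℚ; 0ℚ; 1ℚ; Positive; positive; 1/_)
import Data.Rational.Properties as ℚ
open import Data.Rational.Solver using (module +-*-Solver)
open import Data.Sum.Base using (inj₁; [_,_]′)
open import Data.Vec.Base using ([]; _∷_; here; there; tail)
open import Data.Vec.Properties using (≡-dec)
open import Function.Base using (id)
open import Level using (0ℓ)
open import Relation.Binary.Core using (Rel)
open import Relation.Binary.Definitions using (Decidable; DecidableEquality; Symmetric; Irreflexive)
open import Relation.Binary.PropositionalEquality.Core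
  using (_≡_; refl; sym; trans; cong; subst)
open import Relation.Nullary.Decidable.Core using (yes; no; map′; _×-dec_)
open import Relation.Nullary.Negation.Core using (¬_)

-- Real numbers are Cauchy sequences of rationals; in place of the quotient by
-- null sequences there is the setoid equality _≈_, which is the equality meant
-- wherever real numbers are compared below.

IsCauchy : (ℕ → ℚ) → Set
IsCauchy s = ∀ ε → 0ℚ ℚ.< ε →
  ∃[ N ] (∀ m n → N ℕ.≤ m → N ℕ.≤ n → ℚ.∣ s m ℚ.- s n ∣ ℚ.< ε)

record ℝ : Set where
  constructor _,_
  field
    seq    : ℕ → ℚ
    cauchy : IsCauchy seq

open ℝ public

infix 4 _≈_

record _≈_ (x y : ℝ) : Set where
  constructor *≈*
  field
    close : ∀ ε → 0ℚ ℚ.< ε → ∃[ N ] (∀ n → N ℕ.≤ n → ℚ.∣ seq x n ℚ.- seq y n ∣ ℚ.< ε)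

divide : ∀ ε c → 0ℚ ℚ.< ε → 0ℚ ℚ.< c → ∃[ δ ] (0ℚ ℚ.< δ × c ℚ.* δ ≡ ε)
divide ε c 0<ε 0<c = c⁻¹ ℚ.* ε , ℚ.positive⁻¹ _ {{ℚ.pos*pos⇒pos c⁻¹ ε}} ,
  trans (sym (ℚ.*-assoc c c⁻¹ ε)) (trans (cong (ℚ._* ε) (ℚ.*-inverseʳ c)) (ℚ.*-identityˡ ε))
  where
  instance
    c-pos = positive 0<c
    ε-pos = positive 0<ε
    c-nonZero = ℚ.pos⇒nonZero c
  c⁻¹ = 1/ c
  instance
    c⁻¹-pos : Positive c⁻¹
    c⁻¹-pos = ℚ.1/pos⇒pos c

+-cauchy : ∀ s t → IsCauchy s → IsCauchy t → IsCauchy (λ n → s n ℚ.+ t n)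
+-cauchy s t cs ct ε 0<ε with divide ε (1ℚ ℚ.+ 1ℚ) 0<ε (ℚ.positive⁻¹ _)
... | δ , 0<δ , 2δ≡ε with cs δ 0<δ | ct δ 0<δ
... | M , close₁ | N , close₂ = M ℕ.⊔ N , λ m n M⊔N≤m M⊔N≤n → begin-strict
  ℚ.∣ (s m ℚ.+ t m) ℚ.- (s n ℚ.+ t n) ∣
    ≡⟨ cong ℚ.∣_∣ (solve 4 (λ a b c d → (a :+ b) :- (c :+ d) := (a :- c) :+ (b :- d))
                   refl (s m) (t m) (s n) (t n)) ⟩
  ℚ.∣ (s m ℚ.- s n) ℚ.+ (t m ℚ.- t n) ∣
    ≤⟨ ℚ.∣p+q∣≤∣p∣+∣q∣ (s m ℚ.- s n) (t m ℚ.- t n) ⟩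
  ℚ.∣ s m ℚ.- s n ∣ ℚ.+ ℚ.∣ t m ℚ.- t n ∣
    <⟨ ℚ.+-mono-< (close₁ m n (ℕ.m⊔n≤o⇒m≤o M N M⊔N≤m) (ℕ.m⊔n≤o⇒m≤o M N M⊔N≤n))
                  (close₂ m n (ℕ.m⊔n≤o⇒n≤o M N M⊔N≤m) (ℕ.m⊔n≤o⇒n≤o M N M⊔N≤n)) ⟩
  δ ℚ.+ δ
    ≡⟨ solve 1 (λ d → d :+ d := (con 1ℚ :+ con 1ℚ) :* d) refl δ ⟩
  (1ℚ ℚ.+ 1ℚ) ℚ.* δ
    ≡⟨ 2δ≡ε ⟩
  ε ∎
  where
  open ℚ.≤-Reasoning
  open +-*-Solver

bounded : ∀ s → IsCauchy s →
          ∃[ B ] (0ℚ ℚ.< B × ∃[ N ] (∀ n → N ℕ.≤ n → ℚ.∣ s n ∣ ℚ.≤ B))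
bounded s cs with cs 1ℚ (ℚ.positive⁻¹ 1ℚ)
... | N , close = 1ℚ ℚ.+ ℚ.∣ s N ∣ ,
    ℚ.+-mono-<-≤ (ℚ.positive⁻¹ 1ℚ) (ℚ.0≤∣p∣ (s N)) , N , λ n N≤n → begin
  ℚ.∣ s n ∣
    ≡⟨ cong ℚ.∣_∣ (solve 2 (λ a b → a := (a :- b) :+ b) refl (s n) (s N)) ⟩
  ℚ.∣ (s n ℚ.- s N) ℚ.+ s N ∣
    ≤⟨ ℚ.∣p+q∣≤∣p∣+∣q∣ (s n ℚ.- s N) (s N) ⟩
  ℚ.∣ s n ℚ.- s N ∣ ℚ.+ ℚ.∣ s N ∣
    ≤⟨ ℚ.+-monoˡ-≤ ℚ.∣ s N ∣ (ℚ.<⇒≤ (close n N N≤n ℕ.≤-refl)) ⟩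
  1ℚ ℚ.+ ℚ.∣ s N ∣ ∎
  where
  open ℚ.≤-Reasoning
  open +-*-Solver

*-split : ∀ a b c d → a ℚ.* b ℚ.- c ℚ.* d ≡ a ℚ.* (b ℚ.- d) ℚ.+ d ℚ.* (a ℚ.- c)
*-split = solve 4 (λ a b c d → a :* b :- c :* d := a :* (b :- d) :+ d :* (a :- c)) refl
  where
  open +-*-Solver

*-bound : ∀ p q {B δ} → 0ℚ ℚ.< B → ℚ.∣ p ∣ ℚ.≤ B → ℚ.∣ q ∣ ℚ.< δ →
          ℚ.∣ p ℚ.* q ∣ ℚ.< B ℚ.* δ
*-bound p q {B} {δ} 0<B ∣p∣≤B ∣q∣<δ = begin-strict
  ℚ.∣ p ℚ.* q ∣        ≡⟨ ℚ.∣p*q∣≡∣p∣*∣q∣ p q ⟩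
  ℚ.∣ p ∣ ℚ.* ℚ.∣ q ∣  ≤⟨ ℚ.*-monoʳ-≤-nonNeg ℚ.∣ q ∣ {{ℚ.∣-∣-nonNeg q}} ∣p∣≤B ⟩
  B ℚ.* ℚ.∣ q ∣        <⟨ ℚ.*-monoʳ-<-pos B {{positive 0<B}} ∣q∣<δ ⟩
  B ℚ.* δ              ∎
  where
  open ℚ.≤-Reasoning

*-close : ∀ a b c d {B C δ} → 0ℚ ℚ.< B → 0ℚ ℚ.< C → ℚ.∣ a ∣ ℚ.≤ B → ℚ.∣ d ∣ ℚ.≤ C →
          ℚ.∣ a ℚ.- c ∣ ℚ.< δ → ℚ.∣ b ℚ.- d ∣ ℚ.< δ →
          ℚ.∣ a ℚ.* b ℚ.- c ℚ.* d ∣ ℚ.< (B ℚ.+ C) ℚ.* δ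
*-close a b c d {B} {C} {δ} 0<B 0<C ∣a∣≤B ∣d∣≤C a~c b~d = begin-strict
  ℚ.∣ a ℚ.* b ℚ.- c ℚ.* d ∣
    ≡⟨ cong ℚ.∣_∣ (*-split a b c d) ⟩
  ℚ.∣ a ℚ.* (b ℚ.- d) ℚ.+ d ℚ.* (a ℚ.- c) ∣
    ≤⟨ ℚ.∣p+q∣≤∣p∣+∣q∣ (a ℚ.* (b ℚ.- d)) (d ℚ.* (a ℚ.- c)) ⟩
  ℚ.∣ a ℚ.* (b ℚ.- d) ∣ ℚ.+ ℚ.∣ d ℚ.* (a ℚ.- c) ∣
    <⟨ ℚ.+-mono-< (*-bound a (b ℚ.- d) 0<B ∣a∣≤B b~d) (*-bound d (a ℚ.- c) 0<C ∣d∣≤C a~c) ⟩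
  B ℚ.* δ ℚ.+ C ℚ.* δ
    ≡⟨ ℚ.*-distribʳ-+ δ B C ⟨
  (B ℚ.+ C) ℚ.* δ ∎
  where
  open ℚ.≤-Reasoning

*-cauchy : ∀ s t → IsCauchy s → IsCauchy t → IsCauchy (λ n → s n ℚ.* t n)
*-cauchy s t cs ct ε 0<ε =
  let B , 0<B , N₁ , s≤B = bounded s cs
      C , 0<C , N₂ , t≤C = bounded t ct
      δ , 0<δ , [B+C]δ≡ε = divide ε (B ℚ.+ C) 0<ε (ℚ.+-mono-< 0<B 0<C)
      N₃ , close₁ = cs δ 0<δ
      N₄ , close₂ = ct δ 0<δ
      L = N₁ ℕ.⊔ N₂
      R = N₃ ℕ.⊔ N₄
  in L ℕ.⊔ R , λ m n N≤m N≤n →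
    let L≤m = ℕ.m⊔n≤o⇒m≤o L R N≤m
        R≤m = ℕ.m⊔n≤o⇒n≤o L R N≤m
        L≤n = ℕ.m⊔n≤o⇒m≤o L R N≤n
        R≤n = ℕ.m⊔n≤o⇒n≤o L R N≤n
    in subst (ℚ.∣ s m ℚ.* t m ℚ.- s n ℚ.* t n ∣ ℚ.<_) [B+C]δ≡ε
      (*-close (s m) (t m) (s n) (t n) 0<B 0<C
        (s≤B m (ℕ.m⊔n≤o⇒m≤o N₁ N₂ L≤m)) (t≤C n (ℕ.m⊔n≤o⇒n≤o N₁ N₂ L≤n))
        (close₁ m n (ℕ.m⊔n≤o⇒m≤o N₃ N₄ R≤m) (ℕ.m⊔n≤o⇒m≤o N₃ N₄ R≤n))
        (close₂ m n (ℕ.m⊔n≤o⇒n≤o N₃ N₄ R≤m) (ℕ.m⊔n≤o⇒n≤o N₃ N₄ R≤n)))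

fromℚ : ℚ → ℝ
fromℚ q = (λ _ → q) , λ ε 0<ε → 0 , λ _ _ _ _ →
  subst (λ d → ℚ.∣ d ∣ ℚ.< ε) (sym (ℚ.+-inverseʳ q)) 0<ε

fromℤ : ℤ → ℝ
fromℤ z = fromℚ (z ℚ./ 1)

0ℝ : ℝ
0ℝ = fromℚ 0ℚ

infixl 6 _+_
infixl 7 _*_

_+_ : ℝ → ℝ → ℝ
x + y = (λ n → seq x n ℚ.+ seq y n) , +-cauchy (seq x) (seq y) (cauchy x) (cauchy y)

_*_ : ℝ → ℝ → ℝ
x * y = (λ n → seq x n ℚ.* seq y n) , *-cauchy (seq x) (seq y) (cauchy x) (cauchy y)

record Finite (V : Set) : Set where
  infix 4 _≟_
  field
    elements : List V
    complete : ∀ x → x ∈ˡ elements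
    unique   : Unique elements
    _≟_      : DecidableEquality V

open Finite {{...}} public

∑ : {V : Set} {{_ : Finite V}} → (V → ℝ) → ℝ
∑ f = foldr _+_ 0ℝ (map f elements)

-- A Laplacian matrix is real symmetric, so it is enough to speak of real
-- eigenvalues and real eigenvectors; v is an eigenvector when v ≠ 0 and
-- M v = μ v, the two conjuncts below.
IsEigenvalue : {V : Set} {{_ : Finite V}} → (V → V → ℝ) → ℝ → Set
IsEigenvalue {V} M μ = ∃ λ (v : V → ℝ) →
  (¬ (∀ x → v x ≈ 0ℝ)) × (∀ x → ∑ (λ y → M x y * v y) ≈ μ * v x)

record SimpleGraph (V : Set) : Set₁ where
  field
    Adj      : Rel V 0ℓ
    adj?     : Decidable Adj
    symm     : Symmetric Adj
    loopless : Irreflexive _≡_ Adj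

module _ {V : Set} {{_ : Finite V}} (G : SimpleGraph V) where
  open SimpleGraph G

  degree : V → ℕ
  degree x = length (filter (adj? x) elements)

  degreeMatrix : V → V → ℤ
  degreeMatrix x y with x ≟ y
  ... | yes _ = ℤ.+ degree x
  ... | no  _ = 0ℤ

  adjacencyMatrix : V → V → ℤ
  adjacencyMatrix x y with adj? x y
  ... | yes _ = 1ℤ
  ... | no  _ = 0ℤ

  laplacianMatrix : V → V → ℤ
  laplacianMatrix x y = degreeMatrix x y ℤ.- adjacencyMatrix x y

  IsLaplacianEigenvalue : ℝ → Set
  IsLaplacianEigenvalue = IsEigenvalue (λ x y → fromℤ (laplacianMatrix x y))

record KSubset (n k : ℕ) : Set where
  constructor _,_
  field
    set  : Subset n
    size : ∣ set ∣ ≡ k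

open KSubset public

set-injective : ∀ {n k} {A B : KSubset n k} → set A ≡ set B → A ≡ B
set-injective {A = A , p} {B = .A , q} refl = cong (A ,_) (ℕ.≡-irrelevant p q)

insert : ∀ {n k} → KSubset n k → KSubset (suc n) (suc k)
insert (A , p) = (inside ∷ A) , cong suc p

skip : ∀ {n k} → KSubset n k → KSubset (suc n) k
skip (A , p) = (outside ∷ A) , p

insert-injective : ∀ {n k} {A B : KSubset n k} → insert A ≡ insert B → A ≡ B
insert-injective eq = set-injective (cong (λ C → tail (set C)) eq)

skip-injective : ∀ {n k} {A B : KSubset n k} → skip A ≡ skip B → A ≡ B
skip-injective eq = set-injective (cong (λ C → tail (set C)) eq)

kSubsets : ∀ n k → List (KSubset n k)
kSubsets zero    zero    = ([] , refl) ∷ []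
kSubsets zero    (suc k) = []
kSubsets (suc n) zero    = map skip (kSubsets n zero)
kSubsets (suc n) (suc k) = map insert (kSubsets n k) ++ map skip (kSubsets n (suc k))

kSubsets-complete : ∀ {n k} (A : KSubset n k) → A ∈ˡ kSubsets n k
kSubsets-complete {zero}  {zero}  ([] , refl)          = here refl
kSubsets-complete {suc n} {zero}  ((outside ∷ A) , p)  = ∈-map⁺ skip (kSubsets-complete (A , p))
kSubsets-complete {suc n} {suc k} ((inside ∷ A) , refl) =
  ∈-++⁺ˡ (∈-map⁺ insert (kSubsets-complete (A , refl)))
kSubsets-complete {suc n} {suc k} ((outside ∷ A) , p)  =
  ∈-++⁺ʳ (map insert (kSubsets n k)) (∈-map⁺ skip (kSubsets-complete (A , p)))

kSubsets-unique : ∀ n k → Unique (kSubsets n k)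
kSubsets-unique zero    zero    = [] ∷ []
kSubsets-unique zero    (suc k) = []
kSubsets-unique (suc n) zero    = Unique.map⁺ skip-injective (kSubsets-unique n zero)
kSubsets-unique (suc n) (suc k) = Unique.++⁺
  (Unique.map⁺ insert-injective (kSubsets-unique n k))
  (Unique.map⁺ skip-injective (kSubsets-unique n (suc k)))
  (λ (∈ins , ∈skip) → disjoint (∈-map⁻ insert ∈ins) (∈-map⁻ skip ∈skip))
  where
  disjoint : ∀ {C} → ∃[ A ] (A ∈ˡ kSubsets n k × C ≡ insert A) →
             ¬ (∃[ B ] (B ∈ˡ kSubsets n (suc k) × C ≡ skip B))
  disjoint (_ , _ , refl) (_ , _ , ())

instance
  KSubset-finite : ∀ {n k} → Finite (KSubset n k)
  KSubset-finite {n} {k} = record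
    { elements = kSubsets n k
    ; complete = kSubsets-complete
    ; unique   = kSubsets-unique n k
    ; _≟_      = λ A B → map′ set-injective (cong set) (≡-dec _≟ᵇ_ (set A) (set B))
    }

infixl 6 _△_

_△_ : ∀ {n} → Subset n → Subset n → Subset n
A △ B = (A ─ B) ∪ (B ─ A)

x∈p─q⇒x∉q : ∀ {n} {x : Fin n} (p q : Subset n) → x ∈ p ─ q → x ∉ q
x∈p─q⇒x∉q (_ ∷ p) (outside ∷ q) here      ()
x∈p─q⇒x∉q (_ ∷ p) (inside  ∷ q) (there h) (there h′) = x∈p─q⇒x∉q p q h h′
x∈p─q⇒x∉q (_ ∷ p) (outside ∷ q) (there h) (there h′) = x∈p─q⇒x∉q p q h h′

module _ {n : ℕ} (G : SimpleGraph (Fin n)) (k : ℕ) where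
  open SimpleGraph G

  TokenAdj : Rel (KSubset n k) 0ℓ
  TokenAdj A B = ∃[ a ] ∃[ b ]
    (set A △ set B ≡ ⁅ a ⁆ ∪ ⁅ b ⁆) × (a ∈ set A) × (b ∈ set B) × Adj a b

  tokenGraph : SimpleGraph (KSubset n k)
  tokenGraph = record
    { Adj      = TokenAdj
    ; adj?     = λ A B → any? λ a → any? λ b →
                   ≡-dec _≟ᵇ_ (set A △ set B) (⁅ a ⁆ ∪ ⁅ b ⁆)
                   ×-dec (a ∈? set A) ×-dec (b ∈? set B) ×-dec adj? a b
    ; symm     = λ {A} {B} (a , b , eq , a∈A , b∈B , ab) → b , a ,
                   trans (∪-comm (set B ─ set A) (set A ─ set B)) (trans eq (∪-comm ⁅ a ⁆ ⁅ b ⁆)) ,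
                   b∈B , a∈A , symm ab
    ; loopless = λ { {A} refl (a , b , eq , a∈A , _) →
                   let a∈A△A = subst (a ∈_) (sym eq) (x∈p∪q⁺ (inj₁ (x∈⁅x⁆ a)))
                       a∈A─A = [ id , id ]′ (x∈p∪q⁻ (set A ─ set A) (set A ─ set A) a∈A△A)
                   in x∈p─q⇒x∉q (set A) (set A) a∈A─A a∈A }
    }

{-# OPTIONS --safe #-}
module Submission where

-- Functions on k-subsets are regarded as functions on the whole cube Subset n.
-- There, twice the Laplacian of the token graphs is the single operator
-- ∑ (id - swap a b), over ordered pairs (a , b) of adjacent vertices, so it
-- commutes with (up f) S = ∑_{i ∈ S} f (S - i), which commutes with permutations.
-- Iterating up turns an eigenvector of F_h(G) into one of F_k(G) for the same
-- eigenvalue, unless it is killed; up^ j is injective on level h when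
-- 2 h + j ≤ n, and 2 h + (k - h) ≤ 2 k ≤ n.  Injectivity holds over every
-- torsion-free abelian group, so no order or inner product on ℝ is needed.

open import Algebra.Bundles using (AbelianGroup; Ring)
import Algebra.Morphism.Structures as Morphism
import Algebra.Properties.AbelianGroup as AbelianGroupProperties
import Algebra.Properties.CommutativeMonoid.Mult as Multiples
import Algebra.Properties.CommutativeMonoid.Sum as Sums
import Algebra.Properties.CommutativeSemigroup as CommutativeSemigroupProperties
import Algebra.Properties.Semiring.Mult as SemiringMultiples
open import Data.Bool.Base using (Bool; true; false; _∧_; _∨_; _xor_; not; if_then_else_)
open import Data.Bool.Properties
  using (xor-assoc; xor-comm; xor-same; xor-identityʳ; not-involutive; ∨-comm; ∨-zeroʳ)
  renaming (_≟_ to _≟ᵇ_)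
open import Data.Fin.Base using (Fin; zero; suc)
open import Data.Fin.Permutation using (Permutation′; _⟨$⟩ʳ_; _⟨$⟩ˡ_; transpose; inverseˡ)
import Data.Fin.Permutation.Components as Components
open import Data.Fin.Properties using (suc-injective) renaming (_≟_ to _≟ᶠ_)
open import Data.Fin.Subset using (Subset; inside; outside; ∣_∣; ⊥; ⁅_⁆; _∪_)
open import Data.Integer.Base as ℤ using (ℤ; 0ℤ; 1ℤ)
import Data.Integer.Properties as ℤ
open import Data.List.Base using (List; []; _∷_; foldr; map; filter; length)
open import Data.List.Membership.Propositional using () renaming (_∈_ to _∈ˡ_)
open import Data.List.Relation.Unary.All as All using (All; []; _∷_)
open import Data.List.Relation.Unary.AllPairs using (_∷_)
open import Data.List.Relation.Unary.Any using (here; there)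
open import Data.List.Relation.Unary.Unique.Propositional using (Unique)
open import Data.Nat.Base as ℕ using (zero; suc)
open import Data.Nat.Base using (ℕ; _≤_; _*_)
import Data.Nat.Properties as ℕ
open import Data.Product.Base using (_×_; _,_; proj₁; proj₂; ∃; ∃₂; ∃-syntax)
open import Data.Rational.Base as ℚ using (ℚ; 0ℚ; 1ℚ)
import Data.Rational.Properties as ℚ
open import Data.Rational.Solver using (module +-*-Solver)
import Data.Rational.Unnormalised.Base as ℚᵘ
import Data.Rational.Unnormalised.Properties as ℚᵘ
open import Data.Sum.Base using (_⊎_; inj₁; inj₂)
open import Data.Vec.Base using ([]; _∷_; lookup; tabulate; _[_]≔_)
open import Data.Vec.Properties
  using ( lookup∘tabulate; tabulate∘lookup; tabulate-cong; lookup∘update; lookup∘update′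
        ; lookup-zipWith; lookup⇒[]=; []=⇒lookup; ≡-dec)
open import Defs using (ℝ; SimpleGraph; tokenGraph; IsLaplacianEigenvalue)
open import Defs
  using ( _,_; seq; cauchy; *≈*; IsCauchy; divide; bounded; *-bound; fromℚ; fromℤ; 0ℝ
        ; Finite; elements; complete; unique; _≟_; degree; laplacianMatrix
        ; KSubset; set; size; set-injective; kSubsets; kSubsets-complete; kSubsets-unique
        ; _△_; TokenAdj)
  renaming (_≈_ to _≈ᵣ_; _+_ to _+ᵣ_; _*_ to _*ᵣ_)
open import Function.Base using (_∘_)
open import Level using (0ℓ)
open import Relation.Binary.PropositionalEquality as ≡ using (_≡_; _≢_; _≗_; cong; cong₂)
import Relation.Binary.Reasoning.Setoid as SetoidReasoning
open import Relation.Nullary.Decidable using (Dec; does; yes; no; dec-true; dec-false)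
open import Relation.Nullary.Negation.Core using (¬_; contradiction)
open import Relation.Unary using (Pred; Decidable)

-- Subsets and swaps

-- The obstacle is that token graphs for different `k` have different vertex types, and that the set
-- of legal moves depends on the configuration. On the cube this dependence disappears: swapping two
-- points that are both inside or both outside `S` fixes `S`, so illegal moves contribute zero and
-- the same pairs can be summed for every `S`. Each summand then involves only a permutation of the
-- points. Using ordered pairs costs a factor 2, which torsion-freeness cancels at the end. The
-- threshold 2h + j comes from an induction on n. Splitting off one point leaves either the same
-- level with exponent j - 1, or level h - 1 with exponent j + 1; in both branches 2h + j drops by
-- exactly one, as n does.

subset-ext : ∀ {n} {S T : Subset n} → lookup S ≗ lookup T → S ≡ T
subset-ext {S = S} {T} eq =
  ≡.trans (≡.sym (tabulate∘lookup S)) (≡.trans (tabulate-cong eq) (tabulate∘lookup T))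

-- With cardinality written as a sum over points, its invariance under a permutation is the
-- reindexing of a finite sum.
size-sum : ∀ {n} (S : Subset n) →
           ∣ S ∣ ≡ Sums.sum ℕ.+-0-commutativeMonoid (λ i → if lookup S i then 1 else 0)
size-sum []            = ≡.refl
size-sum (inside  ∷ S) = cong suc (size-sum S)
size-sum (outside ∷ S) = size-sum S

size-remove : ∀ {n} (S : Subset n) i → lookup S i ≡ true → suc ∣ S [ i ]≔ outside ∣ ≡ ∣ S ∣
size-remove (inside  ∷ S) zero    _   = ≡.refl
size-remove (inside  ∷ S) (suc i) i∈S = cong suc (size-remove S i i∈S)
size-remove (outside ∷ S) (suc i) i∈S = size-remove S i i∈S

permute : ∀ {n} → Permutation′ n → Subset n → Subset n
permute π S = tabulate (λ i → lookup S (π ⟨$⟩ʳ i))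

lookup-permute : ∀ {n} (π : Permutation′ n) S i → lookup (permute π S) i ≡ lookup S (π ⟨$⟩ʳ i)
lookup-permute π S = lookup∘tabulate (λ i → lookup S (π ⟨$⟩ʳ i))

size-permute : ∀ {n} (π : Permutation′ n) S → ∣ permute π S ∣ ≡ ∣ S ∣
size-permute π S = begin
  ∣ permute π S ∣                                      ≡⟨ size-sum (permute π S) ⟩
  sum (λ i → if lookup (permute π S) i then 1 else 0)
    ≡⟨ sum-cong-≗ (λ i → cong (if_then 1 else 0) (lookup-permute π S i)) ⟩
  sum (λ i → if lookup S (π ⟨$⟩ʳ i) then 1 else 0)
    ≡⟨ sum-permute (λ i → if lookup S i then 1 else 0) π ⟨
  sum (λ i → if lookup S i then 1 else 0)              ≡⟨ size-sum S ⟨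
  ∣ S ∣                                                ∎
  where
  open ≡.≡-Reasoning
  open Sums ℕ.+-0-commutativeMonoid

permute-remove : ∀ {n} (π : Permutation′ n) (S : Subset n) i →
                 permute π S [ i ]≔ outside ≡ permute π (S [ π ⟨$⟩ʳ i ]≔ outside)
permute-remove π S i = subset-ext λ j →
  ≡.trans (pointwise j) (≡.sym (lookup-permute π (S [ π ⟨$⟩ʳ i ]≔ outside) j))
  where
  pointwise : ∀ j → lookup (permute π S [ i ]≔ outside) j ≡
                    lookup (S [ π ⟨$⟩ʳ i ]≔ outside) (π ⟨$⟩ʳ j)
  pointwise j with j ≟ᶠ i
  ... | yes ≡.refl = ≡.trans (lookup∘update i (permute π S) outside)
                             (≡.sym (lookup∘update (π ⟨$⟩ʳ i) S outside))
  ... | no j≢i = begin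
    lookup (permute π S [ i ]≔ outside) j            ≡⟨ lookup∘update′ j≢i (permute π S) outside ⟩
    lookup (permute π S) j                           ≡⟨ lookup-permute π S j ⟩
    lookup S (π ⟨$⟩ʳ j)                              ≡⟨ lookup∘update′ πj≢πi S outside ⟨
    lookup (S [ π ⟨$⟩ʳ i ]≔ outside) (π ⟨$⟩ʳ j)      ∎
    where
    open ≡.≡-Reasoning
    πj≢πi : π ⟨$⟩ʳ j ≢ π ⟨$⟩ʳ i
    πj≢πi eq = j≢i (≡.trans (≡.sym (inverseˡ π)) (≡.trans (cong (π ⟨$⟩ˡ_) eq) (inverseˡ π)))

swap : ∀ {n} → Fin n → Fin n → Subset n → Subset n
swap a b = permute (transpose a b)

-- This is what makes the terms of `lap` for illegal moves vanish.
swap-trivial : ∀ {n} (a b : Fin n) S → lookup S a ≡ lookup S b → swap a b S ≡ S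
swap-trivial a b S eq = subset-ext λ i → ≡.trans (lookup-permute (transpose a b) S i) (pointwise i)
  where
  pointwise : ∀ i → lookup S (Components.transpose a b i) ≡ lookup S i
  pointwise i with i ≟ᶠ a
  ... | yes ≡.refl = ≡.sym eq
  ... | no _ with i ≟ᶠ b
  ...   | yes ≡.refl = eq
  ...   | no _       = ≡.refl

pairᵇ : ∀ {n} → Fin n → Fin n → Fin n → Bool
pairᵇ a b i = does (i ≟ᶠ a) ∨ does (i ≟ᶠ b)

pairᵇ-left : ∀ {n} (a b : Fin n) → pairᵇ a b a ≡ true
pairᵇ-left a b rewrite dec-true (a ≟ᶠ a) ≡.refl = ≡.refl

pairᵇ-right : ∀ {n} (a b : Fin n) → pairᵇ a b b ≡ true
pairᵇ-right a b rewrite dec-true (b ≟ᶠ b) ≡.refl = ∨-zeroʳ _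

pairᵇ⇒ : ∀ {n} (a b i : Fin n) → pairᵇ a b i ≡ true → i ≡ a ⊎ i ≡ b
pairᵇ⇒ a b i i∈ab with i ≟ᶠ a | i ≟ᶠ b
... | yes i≡a | _       = inj₁ i≡a
... | no _    | yes i≡b = inj₂ i≡b
... | no _    | no _    = contradiction i∈ab λ ()

lookup-singleton : ∀ {n} (a i : Fin n) → lookup ⁅ a ⁆ i ≡ does (i ≟ᶠ a)
lookup-singleton zero    zero    = ≡.refl
lookup-singleton zero    (suc i) = lookup-⊥ i
  where
  lookup-⊥ : ∀ {n} (i : Fin n) → lookup ⊥ i ≡ false
  lookup-⊥ zero    = ≡.refl
  lookup-⊥ (suc i) = lookup-⊥ i
lookup-singleton (suc a) zero    = ≡.refl
lookup-singleton (suc a) (suc i) with i ≟ᶠ a | lookup-singleton a i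
... | yes _ | eq = eq
... | no  _ | eq = eq

lookup-pair : ∀ {n} (a b i : Fin n) → lookup (⁅ a ⁆ ∪ ⁅ b ⁆) i ≡ pairᵇ a b i
lookup-pair a b i = ≡.trans (lookup-zipWith _∨_ i ⁅ a ⁆ ⁅ b ⁆)
                            (cong₂ _∨_ (lookup-singleton a i) (lookup-singleton b i))

lookup-△ : ∀ {n} (S T : Subset n) i → lookup (S △ T) i ≡ lookup S i xor lookup T i
lookup-△ (inside  ∷ S) (inside  ∷ T) zero    = ≡.refl
lookup-△ (inside  ∷ S) (outside ∷ T) zero    = ≡.refl
lookup-△ (outside ∷ S) (inside  ∷ T) zero    = ≡.refl
lookup-△ (outside ∷ S) (outside ∷ T) zero    = ≡.refl
lookup-△ (_       ∷ S) (_       ∷ T) (suc i) = lookup-△ S T i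

xor-cancel : ∀ x y → x xor (x xor y) ≡ y
xor-cancel x y = ≡.trans (≡.sym (xor-assoc x x y)) (cong (_xor y) (xor-same x))

-- If exactly one of `a` and `b` lies in `S`, swapping them toggles both memberships. In this form
-- symmetric differences and swaps are compared by cancelling in `xor`.
lookup-swap : ∀ {n} (S : Subset n) a b → lookup S a ≡ not (lookup S b) →
              ∀ i → lookup (swap a b S) i ≡ lookup S i xor pairᵇ a b i
lookup-swap S a b Sa≡¬Sb i = ≡.trans (lookup-permute (transpose a b) S i) (pointwise i)
  where
  pointwise : ∀ i → lookup S (Components.transpose a b i) ≡ lookup S i xor pairᵇ a b i
  pointwise i with i ≟ᶠ a
  ... | yes ≡.refl rewrite Sa≡¬Sb = ≡.sym (≡.trans (xor-comm _ true) (not-involutive _))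
  ... | no _ with i ≟ᶠ b
  ...   | yes ≡.refl rewrite Sa≡¬Sb = ≡.sym (xor-comm _ true)
  ...   | no _ = ≡.sym (xor-identityʳ _)

swap-comm : ∀ {n} (S : Subset n) a b → lookup S a ≡ not (lookup S b) → swap a b S ≡ swap b a S
swap-comm S a b Sa≡¬Sb = subset-ext λ i → begin
  lookup (swap a b S) i      ≡⟨ lookup-swap S a b Sa≡¬Sb i ⟩
  lookup S i xor pairᵇ a b i ≡⟨ cong (lookup S i xor_) (∨-comm (does (i ≟ᶠ a)) _) ⟩
  lookup S i xor pairᵇ b a i ≡⟨ lookup-swap S b a Sb≡¬Sa i ⟨
  lookup (swap b a S) i      ∎
  where
  open ≡.≡-Reasoning
  Sb≡¬Sa = ≡.trans (≡.sym (not-involutive _)) (cong not (≡.sym Sa≡¬Sb))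

module _ {n} {S : Subset n} {a b : Fin n} (a∈S : lookup S a ≡ true) (b∉S : lookup S b ≡ false) where

  private
    Sa≡¬Sb : lookup S a ≡ not (lookup S b)
    Sa≡¬Sb = ≡.trans a∈S (≡.sym (cong not b∉S))

  △-swap : S △ swap a b S ≡ ⁅ a ⁆ ∪ ⁅ b ⁆
  △-swap = subset-ext λ i → begin
    lookup (S △ swap a b S) i              ≡⟨ lookup-△ S (swap a b S) i ⟩
    lookup S i xor lookup (swap a b S) i   ≡⟨ cong (lookup S i xor_) (lookup-swap S a b Sa≡¬Sb i) ⟩
    lookup S i xor (lookup S i xor pairᵇ a b i) ≡⟨ xor-cancel (lookup S i) _ ⟩
    pairᵇ a b i                            ≡⟨ lookup-pair a b i ⟨
    lookup (⁅ a ⁆ ∪ ⁅ b ⁆) i               ∎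
    where open ≡.≡-Reasoning

  △-pair⇒swap : ∀ {T} → S △ T ≡ ⁅ a ⁆ ∪ ⁅ b ⁆ → T ≡ swap a b S
  △-pair⇒swap {T} eq = subset-ext λ i → begin
    lookup T i                                 ≡⟨ xor-cancel (lookup S i) _ ⟨
    lookup S i xor (lookup S i xor lookup T i) ≡⟨ cong (lookup S i xor_) (lookup-△ S T i) ⟨
    lookup S i xor lookup (S △ T) i
      ≡⟨ cong (lookup S i xor_) (≡.trans (cong (λ R → lookup R i) eq) (lookup-pair a b i)) ⟩
    lookup S i xor pairᵇ a b i                 ≡⟨ lookup-swap S a b Sa≡¬Sb i ⟨
    lookup (swap a b S) i                      ∎
    where open ≡.≡-Reasoning

  -- Cancelling `S` from both swaps recovers the unordered pair; membership in `S` then tells which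
  -- point is the source and which the target.
  swap-unique : ∀ {a′ b′} → lookup S a′ ≡ true → lookup S b′ ≡ false →
                swap a b S ≡ swap a′ b′ S → a ≡ a′ × b ≡ b′
  swap-unique {a′} {b′} a′∈S b′∉S eq
    with pairᵇ⇒ a b a′ (≡.trans (same-pair a′) (pairᵇ-left a′ b′))
       | pairᵇ⇒ a b b′ (≡.trans (same-pair b′) (pairᵇ-right a′ b′))
    where
    same-pair : ∀ i → pairᵇ a b i ≡ pairᵇ a′ b′ i
    same-pair i = begin
      pairᵇ a b i                              ≡⟨ xor-cancel (lookup S i) _ ⟨
      lookup S i xor (lookup S i xor pairᵇ a b i)
        ≡⟨ cong (lookup S i xor_) (lookup-swap S a b Sa≡¬Sb i) ⟨
      lookup S i xor lookup (swap a b S) i     ≡⟨ cong (λ R → lookup S i xor lookup R i) eq ⟩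
      lookup S i xor lookup (swap a′ b′ S) i
        ≡⟨ cong (lookup S i xor_) (lookup-swap S a′ b′ (≡.trans a′∈S (≡.sym (cong not b′∉S))) i) ⟩
      lookup S i xor (lookup S i xor pairᵇ a′ b′ i) ≡⟨ xor-cancel (lookup S i) _ ⟩
      pairᵇ a′ b′ i                            ∎
      where open ≡.≡-Reasoning
  ... | inj₁ a′≡a   | inj₂ b′≡b   = ≡.sym a′≡a , ≡.sym b′≡b
  ... | inj₂ ≡.refl | _           = contradiction (≡.trans (≡.sym a′∈S) b∉S) λ ()
  ... | _           | inj₁ ≡.refl = contradiction (≡.trans (≡.sym a∈S) b′∉S) λ ()

-- Token adjacency records only that `b` lies in the new set. That its target was free follows
-- because `b` belongs to the symmetric difference.
△-pair⇒∉ : ∀ {n} {S T : Subset n} {a b} → S △ T ≡ ⁅ a ⁆ ∪ ⁅ b ⁆ →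
           lookup T b ≡ true → lookup S b ≡ false
△-pair⇒∉ {S = S} {T} {a} {b} eq b∈T = begin
  lookup S b                            ≡⟨ xor-identityʳ _ ⟨
  lookup S b xor false                  ≡⟨ cong (lookup S b xor_) (xor-same true) ⟨
  lookup S b xor (true xor true)        ≡⟨ xor-assoc (lookup S b) true true ⟨
  (lookup S b xor true) xor true        ≡⟨ cong (λ x → (lookup S b xor x) xor true) b∈T ⟨
  (lookup S b xor lookup T b) xor true  ≡⟨ cong (_xor true) b∈△ ⟩
  false                                 ∎
  where
  open ≡.≡-Reasoning
  b∈△ : lookup S b xor lookup T b ≡ true
  b∈△ = ≡.trans (≡.sym (lookup-△ S T b))
    (≡.trans (cong (λ R → lookup R b) eq) (≡.trans (lookup-pair a b b) (pairᵇ-right a b)))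

-- Entries of a graph Laplacian

module _ {V : Set} {{_ : Finite V}} (G : SimpleGraph V) where
  open SimpleGraph G

  laplacian-diagonal : ∀ x → laplacianMatrix G x x ≡ ℤ.+ degree G x
  laplacian-diagonal x with x ≟ x | adj? x x
  ... | yes _  | no _   = ℤ.+-identityʳ _
  ... | yes _  | yes xx = contradiction xx (loopless ≡.refl)
  ... | no x≢x | _      = contradiction ≡.refl x≢x

  laplacian-offDiagonal : ∀ {x y} → y ≢ x →
    laplacianMatrix G x y ≡ (if does (adj? x y) then ℤ.-1ℤ else 0ℤ)
  laplacian-offDiagonal {x} {y} y≢x with x ≟ y | adj? x y
  ... | no _    | yes _ = ≡.refl
  ... | no _    | no _  = ≡.refl
  ... | yes x≡y | _     = contradiction (≡.sym x≡y) y≢x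

-- Operators on functions on the cube

module _ {c ℓ} (A : AbelianGroup c ℓ) where

  open AbelianGroup A
    renaming ( _∙_ to _+_ ; ε to 0# ; _⁻¹ to -_ ; ∙-cong to +-cong
             ; ∙-congˡ to +-congˡ ; ∙-congʳ to +-congʳ
             ; identityˡ to +-identityˡ ; identityʳ to +-identityʳ ; assoc to +-assoc
             ; inverseʳ to -‿inverseʳ ; ⁻¹-cong to -‿cong)
  open AbelianGroupProperties A using (identityʳ-unique; ⁻¹-∙-comm; x∙y⁻¹≈ε⇒x≈y)
  open CommutativeSemigroupProperties commutativeSemigroup using (interchange)
  open Multiples commutativeMonoid using (×-congʳ; ×-distrib-+) renaming (_×_ to _×ₙ_)
  open Sums commutativeMonoid using (sum; sum-cong-≋; ∑-distrib-+; ∑-comm; sum-permute)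
  open Morphism.MonoidMorphisms rawMonoid rawMonoid using (IsMonoidHomomorphism)
  open IsMonoidHomomorphism
  open SetoidReasoning setoid

  -- Additive maps, indicator terms and finite sums

  Endomorphism : (Carrier → Carrier) → Set _
  Endomorphism = IsMonoidHomomorphism

  endomorphism : ∀ {φ} → (∀ {x y} → x ≈ y → φ x ≈ φ y) →
                 (∀ x y → φ (x + y) ≈ φ x + φ y) → Endomorphism φ
  endomorphism {φ} φ-cong φ-+ = record
    { isMagmaHomomorphism = record
      { isRelHomomorphism = record { cong = φ-cong }
      ; homo = φ-+
      }
    ; ε-homo = identityʳ-unique (φ 0#) (φ 0#) (trans (sym (φ-+ 0# 0#)) (φ-cong (+-identityˡ 0#)))
    }

  neg-endo : Endomorphism (-_)
  neg-endo = endomorphism -‿cong (λ x y → sym (⁻¹-∙-comm x y))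

  ×ₙ-endo : ∀ m → Endomorphism (m ×ₙ_)
  ×ₙ-endo m = endomorphism (×-congʳ m) (λ x y → ×-distrib-+ x y m)

  infix 5 _when_

  _when_ : Carrier → Bool → Carrier
  x when b = if b then x else 0#

  when-cong : ∀ b {x y} → x ≈ y → (x when b) ≈ (y when b)
  when-cong true  x≈y = x≈y
  when-cong false x≈y = refl

  when-+ : ∀ b x y → (x + y when b) ≈ (x when b) + (y when b)
  when-+ true  x y = refl
  when-+ false x y = sym (+-identityˡ 0#)

  when-endo : ∀ b → Endomorphism (_when b)
  when-endo b = endomorphism (when-cong b) (when-+ b)

  when-homo : ∀ {φ} → Endomorphism φ → ∀ b x → φ (x when b) ≈ (φ x when b)
  when-homo φ-endo true  x = refl
  when-homo φ-endo false x = ε-homo φ-endo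

  sum-0 : ∀ {n} (g : Fin n → Carrier) → (∀ i → g i ≈ 0#) → sum g ≈ 0#
  sum-0 {zero}  g g≈0 = refl
  sum-0 {suc n} g g≈0 = trans (+-cong (g≈0 zero) (sum-0 (g ∘ suc) (g≈0 ∘ suc))) (+-identityˡ 0#)

  sum-single : ∀ {n} (g : Fin n → Carrier) i → (∀ j → j ≢ i → g j ≈ 0#) → sum g ≈ g i
  sum-single g zero    g≈0 =
    trans (+-congˡ (sum-0 (g ∘ suc) (λ j → g≈0 (suc j) λ ()))) (+-identityʳ (g zero))
  sum-single g (suc i) g≈0 =
    trans (+-cong (g≈0 zero λ ()) (sum-single (g ∘ suc) i (λ j j≢i → g≈0 (suc j) (j≢i ∘ suc-injective))))
          (+-identityˡ (g (suc i)))

  sum-homo : ∀ {φ} → Endomorphism φ → ∀ {n} (g : Fin n → Carrier) → φ (sum g) ≈ sum (φ ∘ g)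
  sum-homo φ-endo {zero}  g = ε-homo φ-endo
  sum-homo φ-endo {suc n} g =
    trans (homo φ-endo (g zero) (sum (g ∘ suc))) (+-congˡ (sum-homo φ-endo (g ∘ suc)))

  listSum : ∀ {v} {V : Set v} → List V → (V → Carrier) → Carrier
  listSum xs g = foldr _+_ 0# (map g xs)

  module _ {v} {V : Set v} where

    listSum-cong : ∀ (xs : List V) {g h : V → Carrier} → (∀ x → g x ≈ h x) → listSum xs g ≈ listSum xs h
    listSum-cong []       g≈h = refl
    listSum-cong (x ∷ xs) g≈h = +-cong (g≈h x) (listSum-cong xs g≈h)

    listSum-+ : ∀ (xs : List V) (g h : V → Carrier) →
                listSum xs (λ x → g x + h x) ≈ listSum xs g + listSum xs h
    listSum-+ []       g h = sym (+-identityˡ 0#)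
    listSum-+ (x ∷ xs) g h = trans (+-congˡ (listSum-+ xs g h))
                                   (interchange (g x) (h x) (listSum xs g) (listSum xs h))

    listSum-0 : ∀ {xs : List V} (g : V → Carrier) → All (λ x → g x ≈ 0#) xs → listSum xs g ≈ 0#
    listSum-0 g []            = refl
    listSum-0 g (gx≈0 ∷ gxs≈0) = trans (+-cong gx≈0 (listSum-0 g gxs≈0)) (+-identityˡ 0#)

    listSum-single : ∀ {xs : List V} (g : V → Carrier) {x} → Unique xs → x ∈ˡ xs →
                     (∀ y → y ≢ x → g y ≈ 0#) → listSum xs g ≈ g x
    listSum-single g {x} (x≢xs ∷ _) (here ≡.refl) g≈0 =
      trans (+-congˡ (listSum-0 g (All.map (λ x≢y → g≈0 _ (x≢y ∘ ≡.sym)) x≢xs))) (+-identityʳ (g x))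
    listSum-single g {x} (z≢xs ∷ xs-unique) (there x∈xs) g≈0 =
      trans (+-cong (g≈0 _ (All.lookup z≢xs x∈xs)) (listSum-single g xs-unique x∈xs g≈0))
            (+-identityˡ (g x))

    listSum-sum : ∀ (xs : List V) {n} (g : V → Fin n → Carrier) →
                  listSum xs (λ x → sum (g x)) ≈ sum (λ i → listSum xs (λ x → g x i))
    listSum-sum []   {n} g = sym (sum-0 {n} (λ _ → 0#) (λ _ → refl))
    listSum-sum (x ∷ xs) g =
      trans (+-congˡ (listSum-sum xs g)) (sym (∑-distrib-+ (g x) (λ i → listSum xs (λ y → g y i))))

    -- Used to spread the diagonal term, degree times value, over the neighbours, so that it can be
    -- combined with the off-diagonal terms one neighbour at a time.
    length-filter-× : ∀ {p} {P : Pred V p} (P? : Decidable P) xs x →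
                      length (filter P? xs) ×ₙ x ≈ listSum xs (λ y → x when does (P? y))
    length-filter-× P? []       x = refl
    length-filter-× P? (y ∷ ys) x with does (P? y)
    ... | true  = +-congˡ (length-filter-× P? ys x)
    ... | false = trans (length-filter-× P? ys x) (sym (+-identityˡ _))

  -- The shadow operator: on functions supported on k-subsets this is the
  -- inclusion matrix of k-subsets against (k + 1)-subsets.

  up : ∀ {n} → (Subset n → Carrier) → Subset n → Carrier
  up f S = sum (λ i → f (S [ i ]≔ outside) when lookup S i)

  up^ : ∀ {n} → ℕ → (Subset n → Carrier) → Subset n → Carrier
  up^ zero    f = f
  up^ (suc j) f = up (up^ j f)

  up-cong : ∀ {n} {f g : Subset n → Carrier} → (∀ S → f S ≈ g S) → ∀ S → up f S ≈ up g S
  up-cong f≈g S = sum-cong-≋ (λ i → when-cong (lookup S i) (f≈g (S [ i ]≔ outside)))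

  up-homo : ∀ {φ} → Endomorphism φ → ∀ {n} (f : Subset n → Carrier) S → φ (up f S) ≈ up (φ ∘ f) S
  up-homo φ-endo f S = trans (sum-homo φ-endo (λ i → f (S [ i ]≔ outside) when lookup S i))
    (sum-cong-≋ (λ i → when-homo φ-endo (lookup S i) (f (S [ i ]≔ outside))))

  up-+ : ∀ {n} (f g : Subset n → Carrier) S → up (λ T → f T + g T) S ≈ up f S + up g S
  up-+ f g S = trans
    (sum-cong-≋ (λ i → when-+ (lookup S i) (f (S [ i ]≔ outside)) (g (S [ i ]≔ outside))))
    (∑-distrib-+ (λ i → f (S [ i ]≔ outside) when lookup S i) _)

  up-- : ∀ {n} (f g : Subset n → Carrier) S → up (λ T → f T - g T) S ≈ up f S - up g S
  up-- f g S = trans (up-+ f (-_ ∘ g) S) (+-congˡ (sym (up-homo neg-endo g S)))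

  up-sum : ∀ {n m} (f : Fin m → Subset n → Carrier) S →
           up (λ T → sum (λ a → f a T)) S ≈ sum (λ a → up (f a) S)
  up-sum f S = trans (sum-cong-≋ (λ i → sum-homo (when-endo (lookup S i)) (λ a → f a (S [ i ]≔ outside))))
                     (∑-comm (λ i a → f a (S [ i ]≔ outside) when lookup S i))

  up-permute : ∀ {n} (f : Subset n → Carrier) π S → up f (permute π S) ≈ up (f ∘ permute π) S
  up-permute f π S = begin
    sum (λ i → f (permute π S [ i ]≔ outside) when lookup (permute π S) i)
      ≈⟨ sum-cong-≋ (λ i → reflexive (cong₂ (λ T b → f T when b)
           (permute-remove π S i) (lookup-permute π S i))) ⟩
    sum (λ i → f (permute π (S [ π ⟨$⟩ʳ i ]≔ outside)) when lookup S (π ⟨$⟩ʳ i))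
      ≈⟨ sum-permute (λ i → f (permute π (S [ i ]≔ outside)) when lookup S i) π ⟨
    up (f ∘ permute π) S ∎

  up-outside : ∀ {n} (f : Subset (suc n) → Carrier) S → up f (outside ∷ S) ≈ up (f ∘ (outside ∷_)) S
  up-outside f S = +-identityˡ _

  up^-outside : ∀ {n} j (f : Subset (suc n) → Carrier) S →
                up^ j f (outside ∷ S) ≈ up^ j (f ∘ (outside ∷_)) S
  up^-outside zero    f S = refl
  up^-outside (suc j) f S = trans (up-outside (up^ j f) S) (up-cong (up^-outside j f) S)

  -- `up^ j f S` sums `f` over all ways of removing `j` points of `S` one after another. The first
  -- point is either removed at one of the `suc j` stages, which gives the multiple, or never
  -- removed, which gives the last term.
  up^-inside : ∀ {n} j (f : Subset (suc n) → Carrier) S →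
               up^ (suc j) f (inside ∷ S) ≈
               suc j ×ₙ up^ j (f ∘ (outside ∷_)) S + up^ (suc j) (f ∘ (inside ∷_)) S
  up^-inside zero    f S = +-congʳ (sym (+-identityʳ _))
  up^-inside (suc j) f S = begin
    up^ (suc j) f (outside ∷ S) + up (λ T → up^ (suc j) f (inside ∷ T)) S
      ≈⟨ +-cong (up^-outside (suc j) f S) (up-cong (up^-inside j f) S) ⟩
    up^ (suc j) f₀ S + up (λ T → suc j ×ₙ up^ j f₀ T + up^ (suc j) f₁ T) S
      ≈⟨ +-congˡ (up-+ (λ T → suc j ×ₙ up^ j f₀ T) (up^ (suc j) f₁) S) ⟩
    up^ (suc j) f₀ S + (up (λ T → suc j ×ₙ up^ j f₀ T) S + up^ (suc (suc j)) f₁ S)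
      ≈⟨ +-congˡ (+-congʳ (up-homo (×ₙ-endo (suc j)) (up^ j f₀) S)) ⟨
    up^ (suc j) f₀ S + (suc j ×ₙ up^ (suc j) f₀ S + up^ (suc (suc j)) f₁ S)
      ≈⟨ +-assoc _ _ _ ⟨
    suc (suc j) ×ₙ up^ (suc j) f₀ S + up^ (suc (suc j)) f₁ S ∎
    where
    f₀ = f ∘ (outside ∷_)
    f₁ = f ∘ (inside ∷_)

  up-0 : ∀ {n} {f : Subset n → Carrier} → (∀ S → f S ≈ 0#) → ∀ S → up f S ≈ 0#
  up-0 {f = f} f≈0 S = sum-0 _ (λ i → trans (when-cong (lookup S i) (f≈0 _)) (ε-homo (when-endo (lookup S i))))

  -- Support on one level, and injectivity of iterated `up`

  SupportedOn : ∀ {n} → ℕ → (Subset n → Carrier) → Set _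
  SupportedOn k f = ∀ S → ∣ S ∣ ≢ k → f S ≈ 0#

  up-supported : ∀ {n k} {f : Subset n → Carrier} → SupportedOn k f → SupportedOn (suc k) (up f)
  up-supported {k = k} {f} f-supp S ∣S∣≢1+k = sum-0 _ vanish
    where
    vanish : ∀ i → (f (S [ i ]≔ outside) when lookup S i) ≈ 0#
    vanish i with lookup S i in i∈S
    ... | true  = f-supp _ λ eq → ∣S∣≢1+k (≡.trans (≡.sym (size-remove S i i∈S)) (cong suc eq))
    ... | false = refl

  up^-supported : ∀ {n k} j {f : Subset n → Carrier} → SupportedOn k f → SupportedOn (j ℕ.+ k) (up^ j f)
  up^-supported zero    f-supp = f-supp
  up^-supported (suc j) f-supp = up-supported (up^-supported j f-supp)

  TorsionFree : Set _
  TorsionFree = ∀ m x → suc m ×ₙ x ≈ 0# → x ≈ 0#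

  ×-cancel : TorsionFree → ∀ m {x y} → suc m ×ₙ x ≈ suc m ×ₙ y → x ≈ y
  ×-cancel tf m {x} {y} mx≈my = x∙y⁻¹≈ε⇒x≈y x y (tf m (x - y) (begin
    suc m ×ₙ (x - y)                ≈⟨ ×-distrib-+ x (- y) (suc m) ⟩
    suc m ×ₙ x + suc m ×ₙ (- y)     ≈⟨ +-cong mx≈my refl ⟩
    suc m ×ₙ y + suc m ×ₙ (- y)     ≈⟨ ×-distrib-+ y (- y) (suc m) ⟨
    suc m ×ₙ (y - y)                ≈⟨ ×-congʳ (suc m) (-‿inverseʳ y) ⟩
    suc m ×ₙ 0#                     ≈⟨ ε-homo (×ₙ-endo (suc m)) ⟩
    0#                              ∎))

  -- Write f₀ and f₁ for the restrictions of f to the subsets avoiding and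
  -- containing the first point.  If up^ (j + 1) kills f, it kills f₀, and one
  -- more up applied to up^-inside shows that up^ (j + 2) kills f₁, hence f₁ = 0;
  -- up^-inside then says that up^ j kills f₀.
  up^-injective : TorsionFree → ∀ n h j (f : Subset n → Carrier) → 2 ℕ.* h ℕ.+ j ≤ n →
                  SupportedOn h f → (∀ S → up^ j f S ≈ 0#) → ∀ S → f S ≈ 0#
  up^-injective tf n       h zero    f 2h+j≤n f-supp up^f≈0 = up^f≈0
  up^-injective tf zero    h (suc j) f 2h+j≤n f-supp up^f≈0 =
    contradiction (≡.subst (_≤ 0) (ℕ.+-suc (2 ℕ.* h) j) 2h+j≤n) λ ()
  up^-injective tf (suc n) h (suc j) f 2h+j≤n f-supp up^f≈0 =
    λ { (outside ∷ S) → f₀≈0 S ; (inside ∷ S) → f₁≈0 S }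
    where
    f₀ f₁ : Subset n → Carrier
    f₀ = f ∘ (outside ∷_)
    f₁ = f ∘ (inside ∷_)

    bound : 2 ℕ.* h ℕ.+ j ≤ n
    bound = ℕ.s≤s⁻¹ (≡.subst (_≤ suc n) (ℕ.+-suc (2 ℕ.* h) j) 2h+j≤n)

    up^f₀≈0 : ∀ S → up^ (suc j) f₀ S ≈ 0#
    up^f₀≈0 S = trans (sym (up^-outside (suc j) f S)) (up^f≈0 (outside ∷ S))

    up^-relation : ∀ S → suc j ×ₙ up^ j f₀ S + up^ (suc j) f₁ S ≈ 0#
    up^-relation S = trans (sym (up^-inside j f S)) (up^f≈0 (inside ∷ S))

    up^f₁≈0 : ∀ S → up^ (suc (suc j)) f₁ S ≈ 0#
    up^f₁≈0 S = begin
      up^ (suc (suc j)) f₁ S                                      ≈⟨ +-identityˡ _ ⟨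
      0# + up^ (suc (suc j)) f₁ S
        ≈⟨ +-congʳ (trans (⟦⟧-cong (×ₙ-endo (suc j)) (up^f₀≈0 S)) (ε-homo (×ₙ-endo (suc j)))) ⟨
      suc j ×ₙ up (up^ j f₀) S + up^ (suc (suc j)) f₁ S
        ≈⟨ +-congʳ (up-homo (×ₙ-endo (suc j)) (up^ j f₀) S) ⟩
      up (λ T → suc j ×ₙ up^ j f₀ T) S + up (up^ (suc j) f₁) S
        ≈⟨ up-+ (λ T → suc j ×ₙ up^ j f₀ T) (up^ (suc j) f₁) S ⟨
      up (λ T → suc j ×ₙ up^ j f₀ T + up^ (suc j) f₁ T) S         ≈⟨ up-0 up^-relation S ⟩
      0#                                                          ∎

    f₁≈0 : ∀ S → f₁ S ≈ 0#
    f₁≈0 = vanish h bound f-supp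
      where
      -- At level zero no set containing the first point is in the support, so there is nothing to
      -- recurse on. Otherwise the level drops by one and `up^` is taken `j + 2` times, and 2(h + 1)
      -- + j = 2h + (j + 2) shows that `bound` already suffices.
      vanish : ∀ h → 2 ℕ.* h ℕ.+ j ≤ n → SupportedOn h f → ∀ S → f₁ S ≈ 0#
      vanish zero    _      f-supp S = f-supp (inside ∷ S) λ ()
      vanish (suc h) bound′ f-supp = up^-injective tf n h (suc (suc j)) f₁
        (≡.subst (_≤ n) (≡.trans (cong (ℕ._+ j) (ℕ.*-suc 2 h)) (ℕ-shift (2 ℕ.* h))) bound′)
        (λ S ∣S∣≢h → f-supp (inside ∷ S) (∣S∣≢h ∘ ℕ.suc-injective)) up^f₁≈0
        where
        ℕ-shift : ∀ m → 2 ℕ.+ m ℕ.+ j ≡ m ℕ.+ suc (suc j)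
        ℕ-shift m = ≡.sym (≡.trans (ℕ.+-suc m (suc j)) (cong suc (ℕ.+-suc m j)))

    up^jf₀≈0 : ∀ S → up^ j f₀ S ≈ 0#
    up^jf₀≈0 S = tf j _ (begin
      suc j ×ₙ up^ j f₀ S                        ≈⟨ +-identityʳ _ ⟨
      suc j ×ₙ up^ j f₀ S + 0#                   ≈⟨ +-congˡ (up^-0 (suc j) f₁≈0 S) ⟨
      suc j ×ₙ up^ j f₀ S + up^ (suc j) f₁ S     ≈⟨ up^-relation S ⟩
      0#                                         ∎)
      where
      up^-0 : ∀ j {g : Subset n → Carrier} → (∀ S → g S ≈ 0#) → ∀ S → up^ j g S ≈ 0#
      up^-0 zero    g≈0 = g≈0
      up^-0 (suc j) g≈0 = up-0 (up^-0 j g≈0)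

    f₀≈0 : ∀ S → f₀ S ≈ 0#
    f₀≈0 = up^-injective tf n h j f₀ bound (λ S → f-supp (outside ∷ S)) up^jf₀≈0

  -- The Laplacian as an operator on the cube

  module _ {n} (G : SimpleGraph (Fin n)) where
    open SimpleGraph G

    -- The sum runs over ordered pairs, so every edge is counted twice; on
    -- k-subsets this is twice the Laplacian of the k-token graph.
    lap : (Subset n → Carrier) → Subset n → Carrier
    lap f S = sum λ a → sum λ b → f S - f (swap a b S) when does (adj? a b)

    lap-up : ∀ f S → lap (up f) S ≈ up (lap f) S
    lap-up f S = sym (begin
      up (lap f) S
        ≈⟨ up-sum (λ a T → sum λ b → f T - f (swap a b T) when does (adj? a b)) S ⟩
      (sum λ a → up (λ T → sum λ b → f T - f (swap a b T) when does (adj? a b)) S)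
        ≈⟨ sum-cong-≋ (λ a → up-sum (λ b T → f T - f (swap a b T) when does (adj? a b)) S) ⟩
      (sum λ a → sum λ b → up (λ T → f T - f (swap a b T) when does (adj? a b)) S)
        ≈⟨ sum-cong-≋ (λ a → sum-cong-≋ λ b →
             up-homo (when-endo (does (adj? a b))) (λ T → f T - f (swap a b T)) S) ⟨
      (sum λ a → sum λ b → up (λ T → f T - f (swap a b T)) S when does (adj? a b))
        ≈⟨ sum-cong-≋ (λ a → sum-cong-≋ λ b → when-cong (does (adj? a b)) (begin
             up (λ T → f T - f (swap a b T)) S     ≈⟨ up-- f (f ∘ swap a b) S ⟩
             up f S - up (f ∘ swap a b) S
               ≈⟨ +-congˡ (-‿cong (up-permute f (transpose a b) S)) ⟨
             up f S - up f (swap a b S)            ∎)) ⟩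
      lap (up f) S ∎)

    -- Only additivity of the eigenvalue action is used: `up` is a sum of values of the function, so
    -- every endomorphism `φ` passes through it.
    lap-up^ : ∀ {φ} → Endomorphism φ → ∀ {f} → (∀ S → lap f S ≈ φ (f S)) →
              ∀ j S → lap (up^ j f) S ≈ φ (up^ j f S)
    lap-up^ φ-endo     eigen zero    = eigen
    lap-up^ {φ} φ-endo {f} eigen (suc j) S = begin
      lap (up (up^ j f)) S     ≈⟨ lap-up (up^ j f) S ⟩
      up (lap (up^ j f)) S     ≈⟨ up-cong (lap-up^ φ-endo eigen j) S ⟩
      up (φ ∘ up^ j f) S       ≈⟨ up-homo φ-endo (up^ j f) S ⟨
      φ (up (up^ j f) S)       ∎

    movable : Subset n → Fin n → Fin n → Bool
    movable S a b = lookup S a ∧ not (lookup S b) ∧ does (adj? a b)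

    adj?-sym : ∀ a b → does (adj? a b) ≡ does (adj? b a)
    adj?-sym a b with adj? a b
    ... | yes ab = ≡.sym (dec-true (adj? b a) (symm ab))
    ... | no ¬ab = ≡.sym (dec-false (adj? b a) (¬ab ∘ symm))

    -- For adjacent points with equal membership the difference is zero. If the memberships differ,
    -- exactly one of the two orientations is movable and both orientations give the same swap.
    -- Exchanging the two summations therefore yields two equal sums.
    lap-movable : ∀ f S → lap f S ≈ 2 ×ₙ (sum λ a → sum λ b → f S - f (swap a b S) when movable S a b)
    lap-movable f S = begin
      (sum λ a → sum λ b → f S - f (swap a b S) when does (adj? a b))
        ≈⟨ sum-cong-≋ (λ a → sum-cong-≋ λ b → split a b) ⟩
      (sum λ a → sum λ b → move a b + move b a)
        ≈⟨ sum-cong-≋ (λ a → ∑-distrib-+ (move a) (λ b → move b a)) ⟩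
      (sum λ a → sum (move a) + sum (λ b → move b a))
        ≈⟨ ∑-distrib-+ (λ a → sum (move a)) (λ a → sum (λ b → move b a)) ⟩
      sum (λ a → sum (move a)) + (sum λ a → sum λ b → move b a)
        ≈⟨ +-congˡ (trans (∑-comm (λ a b → move b a)) (sym (+-identityʳ _))) ⟩
      2 ×ₙ sum (λ a → sum (move a)) ∎
      where
      move : Fin n → Fin n → Carrier
      move a b = f S - f (swap a b S) when movable S a b

      trivial : ∀ a b → lookup S a ≡ lookup S b → (f S - f (swap a b S) when does (adj? a b)) ≈ 0# + 0#
      trivial a b eq = begin
        (f S - f (swap a b S) when does (adj? a b))
          ≈⟨ when-cong (does (adj? a b))
               (+-congˡ (-‿cong (reflexive (cong f (swap-trivial a b S eq))))) ⟩
        (f S - f S when does (adj? a b))   ≈⟨ when-cong (does (adj? a b)) (-‿inverseʳ (f S)) ⟩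
        (0# when does (adj? a b))          ≈⟨ ε-homo (when-endo (does (adj? a b))) ⟩
        0#                                 ≈⟨ +-identityˡ 0# ⟨
        0# + 0#                            ∎

      split : ∀ a b → (f S - f (swap a b S) when does (adj? a b)) ≈ move a b + move b a
      split a b with lookup S a in Sa | lookup S b in Sb
      ... | true  | true  = trivial a b (≡.trans Sa (≡.sym Sb))
      ... | false | false = trivial a b (≡.trans Sa (≡.sym Sb))
      ... | true  | false = sym (+-identityʳ _)
      ... | false | true  = trans
        (reflexive (cong₂ (λ T c → f S - f T when c)
          (swap-comm S a b (≡.trans Sa (cong not (≡.sym Sb)))) (adj?-sym a b)))
        (sym (+-identityˡ _))

    -- Identification with the Laplacian of the token graph

    module _ {k : ℕ} where
      tokenAdj? = SimpleGraph.adj? (tokenGraph G k)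

      movable⇒ : ∀ S a b → movable S a b ≡ true → lookup S a ≡ true × lookup S b ≡ false × Adj a b
      movable⇒ S a b eq with lookup S a | lookup S b | adj? a b
      ... | true | false | yes ab = ≡.refl , ≡.refl , ab

      movable⇐ : ∀ S a b → lookup S a ≡ true → lookup S b ≡ false → Adj a b → movable S a b ≡ true
      movable⇐ S a b a∈S b∉S ab rewrite a∈S | b∉S = dec-true (adj? a b) ab

      swap⇒TokenAdj : ∀ (S T : KSubset n k) a b → movable (set S) a b ≡ true →
                      set T ≡ swap a b (set S) → TokenAdj G k S T
      swap⇒TokenAdj S T a b mov T≡swap with movable⇒ (set S) a b mov
      ... | a∈S , b∉S , ab = a , b ,
        ≡.trans (cong (set S △_) T≡swap) (△-swap a∈S b∉S) ,
        lookup⇒[]= a (set S) a∈S ,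
        lookup⇒[]= b (set T) (≡.trans (cong (λ R → lookup R b) T≡swap) b∈swap) , ab
        where
        b∈swap : lookup (swap a b (set S)) b ≡ true
        b∈swap = ≡.trans (lookup-swap (set S) a b (≡.trans a∈S (cong not (≡.sym b∉S))) b)
                         (cong₂ _xor_ b∉S (pairᵇ-right a b))

      TokenAdj⇒swap : ∀ (S T : KSubset n k) → TokenAdj G k S T →
        ∃₂ λ a b → movable (set S) a b ≡ true × set T ≡ swap a b (set S)
      TokenAdj⇒swap S T (a , b , △≡ , a∈S , b∈T , ab) =
        a , b , movable⇐ (set S) a b Sa Sb ab , △-pair⇒swap Sa Sb △≡
        where
        Sa = []=⇒lookup a∈S
        Sb = △-pair⇒∉ {S = set S} {set T} {a} △≡ ([]=⇒lookup b∈T)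

      _≟ₛ_ : (S T : Subset n) → Dec (S ≡ T)
      _≟ₛ_ = ≡-dec _≟ᵇ_

      pick : ∀ (g : Subset n → Carrier) R → ∣ R ∣ ≡ k →
             listSum (kSubsets n k) (λ T → g (set T) when does (set T ≟ₛ R)) ≈ g R
      pick g R ∣R∣≡k = trans
        (listSum-single (λ T → g (set T) when does (set T ≟ₛ R)) (kSubsets-unique n k)
          (kSubsets-complete (R , ∣R∣≡k)) λ T T≢R →
          reflexive (cong (g (set T) when_) (dec-false (set T ≟ₛ R) (T≢R ∘ set-injective))))
        (reflexive (cong (g R when_) (dec-true (R ≟ₛ R) ≡.refl)))

      -- At most one movable pair leads from S to T, so at most one term is nonzero.
      moves-to : ∀ (S T : KSubset n k) x →
        (sum λ a → sum λ b → ((x when does (set T ≟ₛ swap a b (set S))) when movable (set S) a b))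
        ≈ (x when does (tokenAdj? S T))
      moves-to S T x with tokenAdj? S T
      ... | no ¬adj = sum-0 _ λ a → sum-0 _ λ b → vanish a b
        where
        vanish : ∀ a b → ((x when does (set T ≟ₛ swap a b (set S))) when movable (set S) a b) ≈ 0#
        vanish a b with movable (set S) a b in mov | set T ≟ₛ swap a b (set S)
        ... | false | _       = refl
        ... | true  | no _    = refl
        ... | true  | yes eq  = contradiction (swap⇒TokenAdj S T a b mov eq) ¬adj
      ... | yes adj with TokenAdj⇒swap S T adj
      ...   | a , b , mov , T≡swap = begin
        (sum λ c → sum (term c))    ≈⟨ sum-single _ a (λ c c≢a → sum-0 _ λ d → vanish c d (c≢a ∘ proj₁)) ⟩
        sum (term a)                ≈⟨ sum-single _ b (λ d d≢b → vanish a d (d≢b ∘ proj₂)) ⟩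
        term a b                    ≡⟨ cong₂ (λ p q → (x when p) when q) (dec-true (set T ≟ₛ _) T≡swap) mov ⟩
        x                           ∎
        where
        term : Fin n → Fin n → Carrier
        term c d = (x when does (set T ≟ₛ swap c d (set S))) when movable (set S) c d
        vanish : ∀ c d → ¬ (c ≡ a × d ≡ b) → term c d ≈ 0#
        vanish c d cd≢ab with movable (set S) c d in mov′ | set T ≟ₛ swap c d (set S)
        ... | false | _     = refl
        ... | true  | no _  = refl
        ... | true  | yes eq with movable⇒ (set S) c d mov′ | movable⇒ (set S) a b mov
        ...   | c∈S , d∉S , _ | a∈S , b∉S , _ = contradiction
          (swap-unique {S = set S} c∈S d∉S a∈S b∉S (≡.trans (≡.sym eq) T≡swap)) cd≢ab

      -- A double count: the indicator of `T` being the swap of `S` along `(a , b)` is summed in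
      -- both orders. Over the movable pairs it gives token adjacency, by `moves-to`; over `T` it
      -- selects the single set reached by the swap, which has size `k` and so occurs in the list.
      token-sum : ∀ (g : Subset n → Carrier) (S : KSubset n k) →
        listSum (kSubsets n k) (λ T → g (set T) when does (tokenAdj? S T)) ≈
        (sum λ a → sum λ b → g (swap a b (set S)) when movable (set S) a b)
      token-sum g S = begin
        listSum Ts (λ T → g (set T) when does (tokenAdj? S T))
          ≈⟨ listSum-cong Ts (λ T → moves-to S T (g (set T))) ⟨
        listSum Ts (λ T → sum λ a → sum λ b → term T a b)
          ≈⟨ listSum-sum Ts (λ T a → sum (term T a)) ⟩
        (sum λ a → listSum Ts (λ T → sum (term T a)))
          ≈⟨ sum-cong-≋ (λ a → listSum-sum Ts (λ T → term T a)) ⟩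
        (sum λ a → sum λ b → listSum Ts (λ T → term T a b))
          ≈⟨ sum-cong-≋ (λ a → sum-cong-≋ λ b → collapse a b) ⟩
        (sum λ a → sum λ b → g (swap a b (set S)) when movable (set S) a b) ∎
        where
        Ts = kSubsets n k
        term : KSubset n k → Fin n → Fin n → Carrier
        term T a b = (g (set T) when does (set T ≟ₛ swap a b (set S))) when movable (set S) a b
        collapse : ∀ a b → listSum Ts (λ T → term T a b) ≈ (g (swap a b (set S)) when movable (set S) a b)
        collapse a b with movable (set S) a b
        ... | true  = pick g (swap a b (set S))
                        (≡.trans (size-permute (transpose a b) (set S)) (size S))
        ... | false = listSum-0 {xs = Ts} (λ _ → 0#) (All.universal (λ _ → refl) Ts)

      lap-token : ∀ f (S : KSubset n k) → lap f (set S) ≈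
        2 ×ₙ listSum (kSubsets n k) (λ T → f (set S) - f (set T) when does (tokenAdj? S T))
      lap-token f S = trans (lap-movable f (set S))
        (×-congʳ 2 (sym (token-sum (λ R → f (set S) - f R) S)))

      -- Swaps preserve size, so `lap` does not mix levels. This extends an eigenvalue equation from
      -- the `k`-subsets to the whole cube, as `lap-up^` requires.
      lap-vanishes : ∀ {f} → SupportedOn k f → SupportedOn k (lap f)
      lap-vanishes {f} f-supp S ∣S∣≢k = sum-0 _ λ a → sum-0 _ λ b →
        trans (when-cong (does (adj? a b))
                (trans (+-cong (f-supp S ∣S∣≢k)
                  (-‿cong (f-supp (swap a b S) (∣S∣≢k ∘ ≡.trans (≡.sym (size-permute (transpose a b) S))))))
                  (-‿inverseʳ 0#)))
              (ε-homo (when-endo (does (adj? a b))))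

  -- Extension by zero from one level to the cube

  module _ {n k} (v : KSubset n k → Carrier) where

    extend : Subset n → Carrier
    extend S with ∣ S ∣ ℕ.≟ k
    ... | yes ∣S∣≡k = v (S , ∣S∣≡k)
    ... | no  _     = 0#

    extend-set : ∀ T → extend (set T) ≡ v T
    extend-set T with ∣ set T ∣ ℕ.≟ k
    ... | yes _     = cong v (set-injective ≡.refl)
    ... | no ∣T∣≢k  = contradiction (size T) ∣T∣≢k

    extend-supported : SupportedOn k extend
    extend-supported S ∣S∣≢k with ∣ S ∣ ℕ.≟ k
    ... | yes ∣S∣≡k = contradiction ∣S∣≡k ∣S∣≢k
    ... | no _      = refl

  -- For A = ℝ the action will be z • x = fromℤ z * x; checking conversions between
  -- concrete Cauchy sequences is prohibitively slow, hence the abstraction.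
  module _ (_•_ : ℤ → Carrier → Carrier) (•-cong : ∀ z {x y} → x ≈ y → z • x ≈ z • y)
           (+-• : ∀ d x → (ℤ.+ d) • x ≈ d ×ₙ x) (-1• : ∀ x → ℤ.-1ℤ • x ≈ - x) where

    -- The Laplacian matrix as a sum of differences over neighbours

    module _ {V : Set} {{_ : Finite V}} (G : SimpleGraph V) where
      open SimpleGraph G using (adj?; loopless)

      -- Diagonal and adjacency contributions are kept as two indicator terms so that a row can be
      -- summed separately over each; looplessness makes the second vanish on the diagonal.
      laplacian-entry : ∀ x y (v : V → Carrier) → laplacianMatrix G x y • v y ≈
        (degree G x ×ₙ v x when does (y ≟ x)) + (- v y when does (adj? x y))
      laplacian-entry x y v with y ≟ x
      ... | yes ≡.refl = begin
        laplacianMatrix G x x • v x       ≡⟨ cong (_• v x) (laplacian-diagonal G x) ⟩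
        (ℤ.+ degree G x) • v x            ≈⟨ +-• (degree G x) (v x) ⟩
        degree G x ×ₙ v x                 ≈⟨ +-identityʳ _ ⟨
        degree G x ×ₙ v x + 0#
          ≡⟨ cong (λ b → degree G x ×ₙ v x + (- v x when b)) (dec-false (adj? x x) (loopless ≡.refl)) ⟨
        degree G x ×ₙ v x + (- v x when does (adj? x x)) ∎
      ... | no y≢x = begin
        laplacianMatrix G x y • v y                           ≡⟨ cong (_• v y) (laplacian-offDiagonal G y≢x) ⟩
        (if does (adj? x y) then ℤ.-1ℤ else 0ℤ) • v y         ≈⟨ off (does (adj? x y)) ⟩
        (- v y when does (adj? x y))                         ≈⟨ +-identityˡ _ ⟨
        0# + (- v y when does (adj? x y))                    ∎
        where
        off : ∀ b → (if b then ℤ.-1ℤ else 0ℤ) • v y ≈ (- v y when b)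
        off true  = -1• (v y)
        off false = +-• 0 (v y)

      laplacian-sum : ∀ (v : V → Carrier) x → listSum elements (λ y → laplacianMatrix G x y • v y) ≈
        listSum elements (λ y → v x - v y when does (adj? x y))
      laplacian-sum v x = begin
        listSum elements (λ y → laplacianMatrix G x y • v y)
          ≈⟨ listSum-cong elements (λ y → laplacian-entry x y v) ⟩
        listSum elements (λ y → diag y + off y)        ≈⟨ listSum-+ elements diag off ⟩
        listSum elements diag + listSum elements off ≈⟨ +-congʳ diag-sum ⟩
        listSum elements (λ y → v x when does (adj? x y)) + listSum elements off
          ≈⟨ listSum-+ elements (λ y → v x when does (adj? x y)) off ⟨
        listSum elements (λ y → (v x when does (adj? x y)) + off y)
          ≈⟨ listSum-cong elements (λ y → when-+ (does (adj? x y)) (v x) (- v y)) ⟨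
        listSum elements (λ y → v x - v y when does (adj? x y)) ∎
        where
        diag off : V → Carrier
        diag y = degree G x ×ₙ v x when does (y ≟ x)
        off  y = - v y when does (adj? x y)
        diag-sum : listSum elements diag ≈ listSum elements (λ y → v x when does (adj? x y))
        diag-sum = begin
          listSum elements diag
            ≈⟨ listSum-single diag unique (complete x) (λ y y≢x →
                 reflexive (cong (degree G x ×ₙ v x when_) (dec-false (y ≟ x) y≢x))) ⟩
          diag x              ≡⟨ cong (degree G x ×ₙ v x when_) (dec-true (x ≟ x) ≡.refl) ⟩
          degree G x ×ₙ v x   ≈⟨ length-filter-× (adj? x) elements (v x) ⟩
          listSum elements (λ y → v x when does (adj? x y)) ∎

    -- Lifting eigenvectors from level `h` to level `k`

    module _ {n} (G : SimpleGraph (Fin n)) where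

      tokenLaplacian : ∀ k → (KSubset n k → Carrier) → KSubset n k → Carrier
      tokenLaplacian k v S = listSum elements (λ T → laplacianMatrix (tokenGraph G k) S T • v T)

      lap-tokenLaplacian : ∀ k f (S : KSubset n k) →
        lap G f (set S) ≈ 2 ×ₙ tokenLaplacian k (f ∘ set) S
      lap-tokenLaplacian k f S = trans (lap-token G f S)
        (×-congʳ 2 (sym (laplacian-sum (tokenGraph G k) (f ∘ set) S)))

      -- Here `φ` stands for multiplication by the eigenvalue. Being nonzero is the negation of
      -- vanishing everywhere, so injectivity of `up^ j` transfers it by contraposition, without
      -- locating a nonzero entry.
      eigen-up : TorsionFree → ∀ {φ} → Endomorphism φ →
        ∀ {h k} → h ≤ k → 2 ℕ.* k ≤ n → (v : KSubset n h → Carrier) →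
        ¬ (∀ S → v S ≈ 0#) → (∀ S → tokenLaplacian h v S ≈ φ (v S)) →
        ∃ λ (w : KSubset n k → Carrier) →
          ¬ (∀ S → w S ≈ 0#) × (∀ S → tokenLaplacian k w S ≈ φ (w S))
      eigen-up tf {φ} φ-endo {h} {k} h≤k 2k≤n v v≉0 Lv≈φv = w ∘ set , w≉0 , Lw≈φw
        where
        j = k ℕ.∸ h

        f w : Subset n → Carrier
        f = extend v
        w = up^ j f

        j+h≡k : j ℕ.+ h ≡ k
        j+h≡k = ℕ.m∸n+n≡m h≤k

        2h+j≤n : 2 ℕ.* h ℕ.+ j ≤ n
        2h+j≤n = ℕ.≤-trans (ℕ.≤-trans (ℕ.+-monoʳ-≤ (2 ℕ.* h) (ℕ.m≤n*m j 2))
          (ℕ.≤-reflexive (≡.trans (≡.sym (ℕ.*-distribˡ-+ 2 h j))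
                                  (cong (2 ℕ.*_) (ℕ.m+[n∸m]≡n h≤k))))) 2k≤n

        -- The factor 2 of `lap` is absorbed into the endomorphism, so the eigenvalue equation can
        -- be carried up the cube without dividing.
        2φ : Carrier → Carrier
        2φ x = 2 ×ₙ φ x

        2φ-endo : Endomorphism 2φ
        2φ-endo = endomorphism (×-congʳ 2 ∘ ⟦⟧-cong φ-endo) λ x y →
          trans (×-congʳ 2 (homo φ-endo x y)) (homo (×ₙ-endo 2) (φ x) (φ y))

        lap-f-set : ∀ T → lap G f (set T) ≈ 2φ (f (set T))
        lap-f-set T = begin
          lap G f (set T)                  ≈⟨ lap-tokenLaplacian h f T ⟩
          2 ×ₙ tokenLaplacian h (f ∘ set) T
            ≈⟨ ×-congʳ 2 (listSum-cong elements λ U → •-cong (laplacianMatrix (tokenGraph G h) T U)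
                 (reflexive (extend-set v U))) ⟩
          2 ×ₙ tokenLaplacian h v T        ≈⟨ ×-congʳ 2 (Lv≈φv T) ⟩
          2φ (v T)                           ≡⟨ cong 2φ (extend-set v T) ⟨
          2φ (f (set T))                     ∎

        lap-f : ∀ S → lap G f S ≈ 2φ (f S)
        lap-f S = by-size (∣ S ∣ ℕ.≟ h)
          where
          by-size : Dec (∣ S ∣ ≡ h) → lap G f S ≈ 2φ (f S)
          by-size (yes ∣S∣≡h) = lap-f-set (S , ∣S∣≡h)
          by-size (no ∣S∣≢h)  = begin
            lap G f S   ≈⟨ lap-vanishes G (extend-supported v) S ∣S∣≢h ⟩
            0#            ≈⟨ ε-homo 2φ-endo ⟨
            2φ 0#         ≈⟨ ⟦⟧-cong 2φ-endo (extend-supported v S ∣S∣≢h) ⟨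
            2φ (f S)      ∎

        w≉0 : ¬ (∀ T → w (set T) ≈ 0#)
        w≉0 w∘set≈0 = v≉0 λ T → trans (reflexive (≡.sym (extend-set v T)))
          (up^-injective tf n h j f 2h+j≤n (extend-supported v) w≈0 (set T))
          where
          -- Injectivity asks for vanishing on the whole cube; the assumption covers level `k`, and
          -- the support of `up^ j f` covers the rest.
          w≈0 : ∀ S → w S ≈ 0#
          w≈0 S with ∣ S ∣ ℕ.≟ k
          ... | yes ∣S∣≡k = w∘set≈0 (S , ∣S∣≡k)
          ... | no  ∣S∣≢k = up^-supported j (extend-supported v) S
                              (∣S∣≢k ∘ λ eq → ≡.trans eq j+h≡k)

        Lw≈φw : ∀ T → tokenLaplacian k (w ∘ set) T ≈ φ (w (set T))
        -- `×-cancel` is indexed by the predecessor of the multiple, so `1` cancels the factor 2.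
        Lw≈φw T = ×-cancel tf 1 (begin
          2 ×ₙ tokenLaplacian k (w ∘ set) T   ≈⟨ lap-tokenLaplacian k w T ⟨
          lap G w (set T)                     ≈⟨ lap-up^ G 2φ-endo lap-f j (set T) ⟩
          2φ (w (set T))                        ∎)

-- Real numbers

-- Applied to a difference of sequences this is definitionally the content of `_≈_`, so the
-- congruence laws below reduce to closure properties of null sequences.
IsNull : (ℕ → ℚ) → Set
IsNull s = ∀ ε → 0ℚ ℚ.< ε → ∃[ N ] (∀ n → N ≤ n → ℚ.∣ s n ∣ ℚ.< ε)

null-≤ : ∀ {s t} → (∀ n → ℚ.∣ s n ∣ ℚ.≤ ℚ.∣ t n ∣) → IsNull t → IsNull s
null-≤ s≤t t-null ε 0<ε with t-null ε 0<ε
... | N , t<ε = N , λ n N≤n → ℚ.≤-<-trans (s≤t n) (t<ε n N≤n)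

null-+ : ∀ {s t} → IsNull s → IsNull t → IsNull (λ n → s n ℚ.+ t n)
null-+ {s} {t} s-null t-null ε 0<ε with divide ε (1ℚ ℚ.+ 1ℚ) 0<ε (ℚ.positive⁻¹ _)
... | δ , 0<δ , 2δ≡ε with s-null δ 0<δ | t-null δ 0<δ
... | M , s<δ | N , t<δ = M ℕ.⊔ N , λ n M⊔N≤n → begin-strict
  ℚ.∣ s n ℚ.+ t n ∣          ≤⟨ ℚ.∣p+q∣≤∣p∣+∣q∣ (s n) (t n) ⟩
  ℚ.∣ s n ∣ ℚ.+ ℚ.∣ t n ∣    <⟨ ℚ.+-mono-< (s<δ n (ℕ.m⊔n≤o⇒m≤o M N M⊔N≤n))
                                            (t<δ n (ℕ.m⊔n≤o⇒n≤o M N M⊔N≤n)) ⟩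
  δ ℚ.+ δ                    ≡⟨ solve 1 (λ d → d :+ d := (con 1ℚ :+ con 1ℚ) :* d) ≡.refl δ ⟩
  (1ℚ ℚ.+ 1ℚ) ℚ.* δ          ≡⟨ 2δ≡ε ⟩
  ε                          ∎
  where
  open ℚ.≤-Reasoning
  open +-*-Solver

-- A Cauchy sequence is eventually bounded by some positive `B`, so it suffices to make the null
-- factor smaller than ε / B.
null-* : ∀ {s t} → IsCauchy s → IsNull t → IsNull (λ n → s n ℚ.* t n)
null-* {s} {t} s-cauchy t-null ε 0<ε =
  let B , 0<B , M , s≤B = bounded s s-cauchy
      δ , 0<δ , Bδ≡ε    = divide ε B 0<ε 0<B
      N , t<δ           = t-null δ 0<δ
  in M ℕ.⊔ N , λ n M⊔N≤n → ≡.subst (ℚ.∣ s n ℚ.* t n ∣ ℚ.<_) Bδ≡ε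
       (*-bound (s n) (t n) 0<B (s≤B n (ℕ.m⊔n≤o⇒m≤o M N M⊔N≤n)) (t<δ n (ℕ.m⊔n≤o⇒n≤o M N M⊔N≤n)))

null-≗ : ∀ {s t} → s ≗ t → IsNull t → IsNull s
null-≗ s≗t = null-≤ (λ n → ℚ.≤-reflexive (cong ℚ.∣_∣ (s≗t n)))

null-neg : ∀ {s} → IsNull s → IsNull (λ n → ℚ.- s n)
null-neg {s} = null-≤ (λ n → ℚ.≤-reflexive (ℚ.∣-p∣≡∣p∣ (s n)))

≗⇒≈ : ∀ x y → seq x ≗ seq y → x ≈ᵣ y
≗⇒≈ x y x≗y = *≈* λ ε 0<ε → 0 , λ n _ →
  ≡.subst (ℚ._< ε)
    (cong ℚ.∣_∣ (≡.sym (≡.trans (cong (ℚ._- seq y n) (x≗y n)) (ℚ.+-inverseʳ (seq y n))))) 0<ε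

open +-*-Solver using (solve; _:=_; _:+_; _:-_; _:*_; :-_)

≈-refl : ∀ {x} → x ≈ᵣ x
≈-refl {x} = ≗⇒≈ x x (λ _ → ≡.refl)

≈-sym : ∀ {x y} → x ≈ᵣ y → y ≈ᵣ x
≈-sym {x} {y} (*≈* x~y) = *≈* (null-≗
  (λ n → solve 2 (λ a b → b :- a := :- (a :- b)) ≡.refl (seq x n) (seq y n)) (null-neg x~y))

≈-trans : ∀ {x y z} → x ≈ᵣ y → y ≈ᵣ z → x ≈ᵣ z
≈-trans {x} {y} {z} (*≈* x~y) (*≈* y~z) = *≈* (null-≗
  (λ n → solve 3 (λ a b c → a :- c := (a :- b) :+ (b :- c)) ≡.refl (seq x n) (seq y n) (seq z n))
  (null-+ x~y y~z))

+-cong : ∀ {x y u v} → x ≈ᵣ y → u ≈ᵣ v → x +ᵣ u ≈ᵣ y +ᵣ v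
+-cong {x} {y} {u} {v} (*≈* x~y) (*≈* u~v) = *≈* (null-≗
  (λ n → solve 4 (λ a b c d → (a :+ c) :- (b :+ d) := (a :- b) :+ (c :- d)) ≡.refl
           (seq x n) (seq y n) (seq u n) (seq v n))
  (null-+ x~y u~v))

-- Opaque, because the conversion checker would otherwise compare these proofs
-- whenever it compares negated real numbers.
opaque
  neg-cauchy : ∀ s → IsCauchy s → IsCauchy (λ n → ℚ.- s n)
  neg-cauchy s s-cauchy ε 0<ε = let N , close = s-cauchy ε 0<ε in N , λ m n N≤m N≤n →
    ≡.subst (ℚ._< ε) (≡.sym (≡.trans
      (cong ℚ.∣_∣ (solve 2 (λ a b → (:- a) :- (:- b) := :- (a :- b)) ≡.refl (s m) (s n)))
      (ℚ.∣-p∣≡∣p∣ (s m ℚ.- s n)))) (close m n N≤m N≤n)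

infix 8 -ᵣ_

-ᵣ_ : ℝ → ℝ
-ᵣ x = (λ n → ℚ.- seq x n) , neg-cauchy (seq x) (cauchy x)

-ᵣ-cong : ∀ {x y} → x ≈ᵣ y → -ᵣ x ≈ᵣ -ᵣ y
-ᵣ-cong {x} {y} (*≈* x~y) = *≈* (null-≗
  (λ n → solve 2 (λ a b → (:- a) :- (:- b) := :- (a :- b)) ≡.refl (seq x n) (seq y n)) (null-neg x~y))

*-congˡ : ∀ x {y z} → y ≈ᵣ z → x *ᵣ y ≈ᵣ x *ᵣ z
*-congˡ x {y} {z} (*≈* y~z) = *≈* (null-≗
  (λ n → solve 3 (λ a b c → a :* b :- a :* c := a :* (b :- c)) ≡.refl (seq x n) (seq y n) (seq z n))
  (null-* {seq x} (cauchy x) y~z))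

+-assoc : ∀ x y z → (x +ᵣ y) +ᵣ z ≈ᵣ x +ᵣ (y +ᵣ z)
+-assoc x y z = ≗⇒≈ _ _ (λ n → ℚ.+-assoc (seq x n) (seq y n) (seq z n))

+-comm : ∀ x y → x +ᵣ y ≈ᵣ y +ᵣ x
+-comm x y = ≗⇒≈ _ _ (λ n → ℚ.+-comm (seq x n) (seq y n))

+-identityˡ : ∀ x → 0ℝ +ᵣ x ≈ᵣ x
+-identityˡ x = ≗⇒≈ _ _ (λ n → ℚ.+-identityˡ (seq x n))

+-inverseˡ : ∀ x → -ᵣ x +ᵣ x ≈ᵣ 0ℝ
+-inverseˡ x = ≗⇒≈ _ _ (λ n → ℚ.+-inverseˡ (seq x n))

-- The additive group of the reals and its integer multiples

ℝ-abelianGroup : AbelianGroup 0ℓ 0ℓ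
ℝ-abelianGroup = record
  { Carrier = ℝ ; _≈_ = _≈ᵣ_ ; _∙_ = _+ᵣ_ ; ε = 0ℝ ; _⁻¹ = -ᵣ_
  ; isAbelianGroup = record
    { isGroup = record
      { isMonoid = record
        { isSemigroup = record
          { isMagma = record
            { isEquivalence = record { refl = ≈-refl ; sym = ≈-sym ; trans = ≈-trans }
            ; ∙-cong = +-cong
            }
          ; assoc = +-assoc
          }
        ; identity = +-identityˡ , λ x → ≈-trans (+-comm x 0ℝ) (+-identityˡ x)
        }
      ; inverse = +-inverseˡ , λ x → ≈-trans (+-comm x (-ᵣ x)) (+-inverseˡ x)
      ; ⁻¹-cong = -ᵣ-cong
      }
    ; comm = +-comm
    }
  }

open AbelianGroup ℝ-abelianGroup using (setoid; commutativeMonoid)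
open Multiples commutativeMonoid using () renaming (_×_ to _×ₙ_)
open SemiringMultiples (Ring.semiring ℚ.+-*-ring) using (×-assoc-*) renaming (_×_ to _×ℚ_)

*-endo : ∀ x → Endomorphism ℝ-abelianGroup (x *ᵣ_)
*-endo x = endomorphism ℝ-abelianGroup (*-congˡ x)
  (λ y z → ≗⇒≈ _ _ (λ n → ℚ.*-distribˡ-+ (seq x n) (seq y n) (seq z n)))

seq-× : ∀ m x n → seq (m ×ₙ x) n ≡ (m ×ℚ 1ℚ) ℚ.* seq x n
seq-× m x n = ≡.trans (pointwise m)
  (≡.sym (≡.trans (×-assoc-* m 1ℚ (seq x n)) (cong (m ×ℚ_) (ℚ.*-identityˡ (seq x n)))))
  where
  pointwise : ∀ m → seq (m ×ₙ x) n ≡ m ×ℚ seq x n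
  pointwise zero    = ≡.refl
  pointwise (suc m) = cong (seq x n ℚ.+_) (pointwise m)

×ℚ-nonNegative : ∀ m → ℚ.NonNegative (m ×ℚ 1ℚ)
×ℚ-nonNegative zero    = _
×ℚ-nonNegative (suc m) = ℚ.nonNeg+nonNeg⇒nonNeg 1ℚ (m ×ℚ 1ℚ) {{×ℚ-nonNegative m}}

-- A multiple is termwise the product with a positive rational `c`. Multiplying by the constant
-- sequence of its inverse recovers `x` exactly, term by term, and respects `_≈_`.
ℝ-torsionFree : TorsionFree ℝ-abelianGroup
ℝ-torsionFree m x [1+m]x≈0 = begin
  x                       ≈⟨ ≗⇒≈ x (c⁻¹ *ᵣ (suc m ×ₙ x)) (λ n → ≡.sym (cancel n)) ⟩
  c⁻¹ *ᵣ (suc m ×ₙ x)     ≈⟨ *-congˡ c⁻¹ {suc m ×ₙ x} {0ℝ} [1+m]x≈0 ⟩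
  c⁻¹ *ᵣ 0ℝ               ≈⟨ ≗⇒≈ (c⁻¹ *ᵣ 0ℝ) 0ℝ (λ _ → ℚ.*-zeroʳ (ℚ.1/ c)) ⟩
  0ℝ                      ∎
  where
  open SetoidReasoning setoid
  c : ℚ
  c = suc m ×ℚ 1ℚ
  instance
    c-positive : ℚ.Positive c
    c-positive = ℚ.pos+nonNeg⇒pos 1ℚ (m ×ℚ 1ℚ) {{×ℚ-nonNegative m}}
    c-nonZero : ℚ.NonZero c
    c-nonZero = ℚ.pos⇒nonZero c
  c⁻¹ : ℝ
  c⁻¹ = fromℚ (ℚ.1/ c)
  cancel : ∀ n → (ℚ.1/ c) ℚ.* seq (suc m ×ₙ x) n ≡ seq x n
  cancel n = ≡.trans (cong ((ℚ.1/ c) ℚ.*_) (seq-× (suc m) x n))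
    (≡.trans (≡.sym (ℚ.*-assoc (ℚ.1/ c) c (seq x n)))
      (≡.trans (cong (ℚ._* seq x n) (ℚ.*-inverseˡ c)) (ℚ.*-identityˡ (seq x n))))

-- `ℚ._/_` divides out a gcd, so the identity is checked on unnormalised rationals, where it is
-- integer arithmetic over denominator one.
/1-suc : ∀ d → ℤ.+ suc d ℚ./ 1 ≡ 1ℚ ℚ.+ (ℤ.+ d ℚ./ 1)
/1-suc d = ℚ.toℚᵘ-injective (begin
  ℚ.toℚᵘ (ℤ.+ suc d ℚ./ 1)                 ≈⟨ ℚ.toℚᵘ-fromℚᵘ (ℚᵘ.mkℚᵘ (ℤ.+ suc d) 0) ⟩
  ℚᵘ.mkℚᵘ (ℤ.+ suc d) 0
    ≈⟨ ℚᵘ.*≡* (cong (λ z → (1ℤ ℤ.+ z) ℤ.* 1ℤ) (≡.sym (ℤ.*-identityʳ (ℤ.+ d)))) ⟩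
  ℚ.toℚᵘ 1ℚ ℚᵘ.+ ℚᵘ.mkℚᵘ (ℤ.+ d) 0
    ≈⟨ ℚᵘ.+-congʳ (ℚ.toℚᵘ 1ℚ) (ℚ.toℚᵘ-fromℚᵘ (ℚᵘ.mkℚᵘ (ℤ.+ d) 0)) ⟨
  ℚ.toℚᵘ 1ℚ ℚᵘ.+ ℚ.toℚᵘ (ℤ.+ d ℚ./ 1)      ≈⟨ ℚ.toℚᵘ-homo-+ 1ℚ (ℤ.+ d ℚ./ 1) ⟨
  ℚ.toℚᵘ (1ℚ ℚ.+ (ℤ.+ d ℚ./ 1))            ∎)
  where open SetoidReasoning ℚᵘ.≃-setoid

/1-× : ∀ d → ℤ.+ d ℚ./ 1 ≡ d ×ℚ 1ℚ
/1-× zero    = ≡.refl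
/1-× (suc d) = ≡.trans (/1-suc d) (cong (1ℚ ℚ.+_) (/1-× d))

fromℤ-* : ∀ d x → fromℤ (ℤ.+ d) *ᵣ x ≈ᵣ d ×ₙ x
fromℤ-* d x = ≗⇒≈ (fromℤ (ℤ.+ d) *ᵣ x) (d ×ₙ x) (λ n →
  ≡.trans (cong (ℚ._* seq x n) (/1-× d)) (≡.sym (seq-× d x n)))

fromℤ-neg-1 : ∀ x → fromℤ ℤ.-1ℤ *ᵣ x ≈ᵣ -ᵣ x
fromℤ-neg-1 x = ≗⇒≈ (fromℤ ℤ.-1ℤ *ᵣ x) (-ᵣ x) (λ n →
  ≡.trans (≡.sym (ℚ.neg-distribˡ-* 1ℚ (seq x n))) (cong ℚ.-_ (ℚ.*-identityˡ (seq x n))))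

theorem4p1 : (n : ℕ) (G : SimpleGraph (Fin n)) (h k : ℕ) →
    1 ≤ h → h ≤ k → 2 * k ≤ n →
    (μ : ℝ) →
    IsLaplacianEigenvalue (tokenGraph G h) μ →
    IsLaplacianEigenvalue (tokenGraph G k) μ
theorem4p1 n G h k _ h≤k 2k≤n μ (v , v≉0 , Lv≈μv) =
  -- `∑` and `listSum elements` unfold to the same fold, so the eigenvalue hypothesis and the result
  -- fit without conversion.
  eigen-up ℝ-abelianGroup (λ z x → fromℤ z *ᵣ x) (λ z → *-congˡ (fromℤ z)) fromℤ-* fromℤ-neg-1
    G ℝ-torsionFree (*-endo μ) h≤k 2k≤n v v≉0 Lv≈μv
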